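{- Let $n\ge1$. Among all words in $\mathbf c,\mathbf d$ of degree $2n+2$, the word $\mathbf c\mathbf d^n\mathbf c$ has the maximum value of $\beta$. Among all words in $\mathbf c,\mathbf d$ of degree $2n+5$, the words $\mathbf c\mathbf d\mathbf c\mathbf d^n\mathbf c$ and $\mathbf c\mathbf d^n\mathbf c\mathbf d\mathbf c$ have the maximum value of $\beta$.
   Context: $\deg\mathbf c=1$, $\deg\mathbf d=2$. For a graded poset $P$ of rank $r+1$ with $\hat0,\hat1$ and $S\subseteq[r]$, $f_S$ counts chains $\hat0<x_1<\dots<x_j<\hat1$ with rank set $S$, $h_S=\sum_{T\subseteq S}(-1)^{|S-T|}f_T$, and the ab-index is $\sum_S h_S u_1\cdots u_r$ with $u_i=\mathbf b$ if $i\in S$, $\mathbf a$ otherwise. For Eulerian $P$ it is uniquely a polynomial $\Psi(P)$ in the non-commuting variables $\mathbf c=\mathbf a+\mathbf b$, $\mathbf d=\mathbf a\mathbf b+\mathbf b\mathbf a$. $B_{r+1}$ is the Boolean lattice of subsets of $[r+1]$. For a word $v$ of degree $r$, $\beta(v)$ is the coefficient of $v$ in $\Psi(B_{r+1})$. -}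

module Defs where

open import Data.Bool using (Bool; true; false; _∧_; if_then_else_)
open import Data.Nat using (ℕ; zero; suc; _+_; _∸_; _≡ᵇ_)
open import Data.Integer using (ℤ; +_; -_) renaming (_+_ to _+ℤ_; _*_ to _*ℤ_; _^_ to _^ℤ_)
open import Relation.Binary.PropositionalEquality using (_≡_)
open import Data.List using (List; []; _∷_; _++_; map; length; filterᵇ; replicate; foldr; concatMap)

allSubsets : ℕ → List (List Bool)
allSubsets zero    = [] ∷ []
allSubsets (suc m) = map (true ∷_) (allSubsets m) ++ map (false ∷_) (allSubsets m)

_⊆ᵇ_ : List Bool → List Bool → Bool
[] ⊆ᵇ _ = true
(true ∷ xs) ⊆ᵇ (true ∷ ys) = xs ⊆ᵇ ys
(true ∷ xs) ⊆ᵇ (false ∷ ys) = false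
(true ∷ xs) ⊆ᵇ [] = false
(false ∷ xs) ⊆ᵇ (_ ∷ ys) = xs ⊆ᵇ ys
(false ∷ xs) ⊆ᵇ [] = xs ⊆ᵇ []

card : List Bool → ℕ
card [] = 0
card (true ∷ xs) = suc (card xs)
card (false ∷ xs) = card xs

-- 1-based positions of `true` entries: a set S ⊆ [r] given as a boolean list of length r
positionsFrom : ℕ → List Bool → List ℕ
positionsFrom k [] = []
positionsFrom k (true ∷ xs) = k ∷ positionsFrom (suc k) xs
positionsFrom k (false ∷ xs) = positionsFrom (suc k) xs

rankSet : List Bool → List ℕ
rankSet = positionsFrom 1

sumℕ : List ℕ → ℕ
sumℕ = foldr _+_ 0

sumℤ : List ℤ → ℤ
sumℤ = foldr _+ℤ_ (+ 0)

-- number of chains y < x_1 < ... < x_j in B_m with ranks (ascending) s_1 < ... < s_j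
chainsAbove : (m : ℕ) → List Bool → List ℕ → ℕ
chainsAbove m y [] = 1
chainsAbove m y (s ∷ ss) =
  sumℕ (map (λ x → chainsAbove m x ss)
            (filterᵇ (λ x → (y ⊆ᵇ x) ∧ (card x ≡ᵇ s)) (allSubsets m)))

-- Flag f-vector of B_{r+1}: S ⊆ [r] given as a boolean list of length r.
-- f_S = #chains 0̂ < x_1 < ... < x_j < 1̂ with rank set S.
fB : List Bool → ℕ
fB S = chainsAbove (suc (length S)) (replicate (suc (length S)) false) (rankSet S)

subsetsOf : List Bool → List (List Bool)
subsetsOf [] = [] ∷ []
subsetsOf (true ∷ xs) = map (true ∷_) (subsetsOf xs) ++ map (false ∷_) (subsetsOf xs)
subsetsOf (false ∷ xs) = map (false ∷_) (subsetsOf xs)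

hB : List Bool → ℤ
hB S = sumℤ (map (λ T → ((- (+ 1)) ^ℤ (card S ∸ card T)) *ℤ (+ fB T)) (subsetsOf S))

-- The ab-index of B_{r+1} is Σ_S h_S u_1⋯u_r, so the coefficient of the
-- ab-word w (false = a, true = b, i ∈ S iff u_i = b) is hB w.

data CD : Set where
  c d : CD

deg : List CD → ℕ
deg [] = 0
deg (c ∷ v) = suc (deg v)
deg (d ∷ v) = suc (suc (deg v))

cdWords : ℕ → List (List CD)
cdWords zero = [] ∷ []
cdWords (suc zero) = (c ∷ []) ∷ []
cdWords (suc (suc r)) = map (c ∷_) (cdWords (suc r)) ++ map (d ∷_) (cdWords r)

-- expansion of a cd-word into ab-words, via c = a + b, d = ab + ba
-- (as a list of ab-words with multiplicity)
expand : List CD → List (List Bool)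
expand [] = [] ∷ []
expand (c ∷ v) = map (false ∷_) (expand v) ++ map (true ∷_) (expand v)
expand (d ∷ v) = map (λ u → false ∷ true ∷ u) (expand v) ++ map (λ u → true ∷ false ∷ u) (expand v)

eqBool : Bool → Bool → Bool
eqBool true true = true
eqBool false false = true
eqBool _ _ = false

eqWord : List Bool → List Bool → Bool
eqWord [] [] = true
eqWord (x ∷ xs) (y ∷ ys) = eqBool x y ∧ eqWord xs ys
eqWord _ _ = false

abCoeff : List CD → List Bool → ℕ
abCoeff v w = length (filterᵇ (eqWord w) (expand v))

-- β is the family of cd-index coefficients of the Boolean lattices:
-- for every r, Σ_{v of degree r} β(v)·v, expanded in a,b, equals the ab-index of B_{r+1}.
-- (The cd-index is unique, so this determines β.)
IsBooleanCDIndex : (List CD → ℤ) → Set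
IsBooleanCDIndex β = (w : List Bool) →
  sumℤ (map (λ v → β v *ℤ (+ abCoeff v w)) (cdWords (length w))) ≡ hB w

dPow : ℕ → List CD
dPow zero = []
dPow (suc n) = d ∷ dPow n

{-# OPTIONS --safe #-}
-- Put e(v) = β(v) / (deg v + 1)! and E(t) = Σₙ Ψ(Bₙ) tⁿ / n!.  Since h_S(B_{r+1}) counts the permutations of
-- [r+1] with descent set S, cutting a permutation at its largest or at its smallest letter gives
-- E′ = (1 + Ea)(1 + bE) and E′ = (1 + Eb)(1 + aE), with sum 2E′ = 2 + cE + Ec + EdE.  Comparing
-- coefficients of cd-words yields a recursion for e all of whose terms are nonnegative.
-- By induction it implies e(u cc v) ≤ e(u d v), so only words without a factor cc matter, and
-- 2 e(dᵃ c v) = e(dᵃ) e(v) when v does not begin with c.  So on such words e is a product of the numbers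
-- sₙ = e(dⁿ), for which Σ sₙ x²ⁿ⁺¹ = √2 tan(x/√2), and four inequalities remain to be proved:
-- s_a s_b ≤ s_{a+b},  6 s_{a+1} s_{b+1} ≤ s_{a+b+1},  s_{n+1} ≤ 5 s_{n+2},  24 s_{n+2} ≤ s_n.
module Submission where

open import Defs
open import Data.Bool using (Bool; true; false; _∧_)
open import Data.Bool.Properties using (∧-zeroʳ)
open import Data.Empty using (⊥; ⊥-elim)
open import Data.Integer as ℤ using (ℤ; +_)
import Data.Integer.Properties as ℤ
open import Data.List using (List; []; _∷_; _++_; map; length; filterᵇ; replicate)
open import Data.List.Properties using (map-∘; ++-assoc; length-replicate)
open import Data.Nat as ℕ using (ℕ; zero; suc; z≤n; s≤s; _∸_; _!; _≡ᵇ_)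
open import Data.Nat.Combinatorics using (_C_; nCk≡n!/k![n-k]!; k![n∸k]!∣n!; nCk+nC[k+1]≡[n+1]C[k+1])
open import Data.Nat.DivMod using (m/n*n≡m)
import Data.Nat.Properties as ℕ
import Data.Nat.Tactic.RingSolver as ℕ-Solver
open import Data.Product using (_×_; _,_)
open import Data.Rational as ℚ using (ℚ; 0ℚ; 1ℚ; ½; _/_; _+_; _*_; _-_; -_; _≤_; Positive; nonNegative)
import Data.Rational.Properties as ℚ
open import Data.Rational.Unnormalised as ℚᵘ using (mkℚᵘ; *≡*)
import Data.Rational.Unnormalised.Properties as ℚᵘ
open import Data.Unit using (⊤; tt)
open import Function using (_∘_)
open import Level using (0ℓ)
open import Relation.Binary.PropositionalEquality
open import Relation.Nullary.Decidable using (dec⇒maybe)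
open import Tactic.RingSolver using (solve-∀)
open import Tactic.RingSolver.Core.AlmostCommutativeRing using (AlmostCommutativeRing; fromCommutativeRing)

-- Factorials and binomial coefficients in ℚ

-- Permutations are only the motivation: both equations for E′ are proved by induction from the
-- inclusion-exclusion form of the flag numbers. Neither equation alone can be written in c and d,
-- only their sum can. Dividing by the factorial makes differentiation multiply e(v) by deg v + 1,
-- and deg + 1 is additive over dᵃ c v, the word dᵃ and the word v sharing it; this is the source of
-- the product formula. Each letter c costs a factor 1/2, while s_{n+1} / s_n tends to 2/π², about
-- 1/5. The number of letters c has the parity of the degree, and merging leaves at most three of
-- them. The close contest is in odd degree: one c allows up to s_{n+2} / 2, the claimed maximum is
-- s_1 s_n / 8, and in the limit the two differ by less than 2 percent. Hence the constants: 24 = 4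
-- / s_1 is what this comparison demands, 6 = 1 / s_1 gives equality at a = 0 in the second
-- inequality, and 5 = s_1 / s_2.

ℚ-ring : AlmostCommutativeRing 0ℓ 0ℓ
ℚ-ring = fromCommutativeRing ℚ.+-*-commutativeRing (λ x → dec⇒maybe (0ℚ ℚ.≟ x))

opaque
  fromℤ : ℤ → ℚ
  fromℤ i = i / 1

  toℚᵘ-fromℤ : ∀ i → ℚ.toℚᵘ (fromℤ i) ℚᵘ.≃ mkℚᵘ i 0
  toℚᵘ-fromℤ i = ℚ.toℚᵘ-fromℚᵘ (mkℚᵘ i 0)

  fromℤ-+ : ∀ i j → fromℤ (i ℤ.+ j) ≡ fromℤ i + fromℤ j
  fromℤ-+ i j = ℚ.toℚᵘ-injective (begin
    ℚ.toℚᵘ (fromℤ (i ℤ.+ j))                 ≈⟨ toℚᵘ-fromℤ (i ℤ.+ j) ⟩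
    mkℚᵘ (i ℤ.+ j) 0                      ≈⟨ *≡* (cong (ℤ._* + 1) (sym (cong₂ ℤ._+_ (ℤ.*-identityʳ i) (ℤ.*-identityʳ j)))) ⟩
    mkℚᵘ i 0 ℚᵘ.+ mkℚᵘ j 0                ≈⟨ ℚᵘ.+-cong (toℚᵘ-fromℤ i) (toℚᵘ-fromℤ j) ⟨
    ℚ.toℚᵘ (fromℤ i) ℚᵘ.+ ℚ.toℚᵘ (fromℤ j)      ≈⟨ ℚ.toℚᵘ-homo-+ (fromℤ i) (fromℤ j) ⟨
    ℚ.toℚᵘ (fromℤ i + fromℤ j)                  ∎)
    where open ℚᵘ.≃-Reasoning

  fromℤ-* : ∀ i j → fromℤ (i ℤ.* j) ≡ fromℤ i * fromℤ j
  fromℤ-* i j = ℚ.toℚᵘ-injective (begin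
    ℚ.toℚᵘ (fromℤ (i ℤ.* j))                 ≈⟨ toℚᵘ-fromℤ (i ℤ.* j) ⟩
    mkℚᵘ i 0 ℚᵘ.* mkℚᵘ j 0                ≈⟨ ℚᵘ.*-cong (toℚᵘ-fromℤ i) (toℚᵘ-fromℤ j) ⟨
    ℚ.toℚᵘ (fromℤ i) ℚᵘ.* ℚ.toℚᵘ (fromℤ j)      ≈⟨ ℚ.toℚᵘ-homo-* (fromℤ i) (fromℤ j) ⟨
    ℚ.toℚᵘ (fromℤ i * fromℤ j)                  ∎)
    where open ℚᵘ.≃-Reasoning

  fromℤ-cancel-≤ : ∀ {i j} → fromℤ i ℚ.≤ fromℤ j → i ℤ.≤ j
  fromℤ-cancel-≤ {i} {j} p = subst₂ ℤ._≤_ (ℤ.*-identityʳ i) (ℤ.*-identityʳ j) (ℚᵘ.drop-*≤* q)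
    where
    open ℚᵘ.≤-Reasoning
    q : mkℚᵘ i 0 ℚᵘ.≤ mkℚᵘ j 0
    q = begin
      mkℚᵘ i 0        ≃⟨ toℚᵘ-fromℤ i ⟨
      ℚ.toℚᵘ (fromℤ i)   ≤⟨ ℚ.toℚᵘ-mono-≤ p ⟩
      ℚ.toℚᵘ (fromℤ j)   ≃⟨ toℚᵘ-fromℤ j ⟩
      mkℚᵘ j 0        ∎

  fromℤ-/1 : ∀ i → fromℤ i ≡ i / 1
  fromℤ-/1 i = refl

  ι-pos : ∀ n → Positive (fromℤ (+ suc n))
  ι-pos n = ℚ.normalize-pos (suc n) 1

ι : ℕ → ℚ
ι n = fromℤ (+ n)

ι-+ : ∀ m n → ι (m ℕ.+ n) ≡ ι m + ι n
ι-+ m n = fromℤ-+ (+ m) (+ n)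

ι-* : ∀ m n → ι (m ℕ.* n) ≡ ι m * ι n
ι-* m n = trans (cong fromℤ (ℤ.pos-* m n)) (fromℤ-* (+ m) (+ n))

ι-suc : ∀ n → ι (suc n) ≡ 1ℚ + ι n
ι-suc n = trans (ι-+ 1 n) (cong (_+ ι n) (fromℤ-/1 (+ 1)))

opaque
  invFact : ℕ → ℚ
  invFact zero    = 1ℚ
  invFact (suc p) = invFact p * (+ 1 / suc p)

  ι-recip : ∀ p → ι (suc p) * (+ 1 / suc p) ≡ 1ℚ
  ι-recip p = ℚ.toℚᵘ-injective (begin
    ℚ.toℚᵘ (ι (suc p) * (+ 1 / suc p))                   ≈⟨ ℚ.toℚᵘ-homo-* (ι (suc p)) (+ 1 / suc p) ⟩
    ℚ.toℚᵘ (ι (suc p)) ℚᵘ.* ℚ.toℚᵘ (+ 1 / suc p)         ≈⟨ ℚᵘ.*-cong (toℚᵘ-fromℤ (+ suc p)) (ℚ.toℚᵘ-fromℚᵘ (mkℚᵘ (+ 1) p)) ⟩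
    mkℚᵘ (+ suc p) 0 ℚᵘ.* mkℚᵘ (+ 1) p                   ≈⟨ *≡* (cong +_ (trans (cong (ℕ._* 1) (ℕ.*-identityʳ (suc p))) (trans (ℕ.*-identityʳ (suc p)) (sym (trans (ℕ.*-identityˡ _) (ℕ.*-identityˡ (suc p))))))) ⟩
    mkℚᵘ (+ 1) 0                                         ∎)
    where open ℚᵘ.≃-Reasoning

  ι-invFact : ∀ p → ι (suc p) * invFact (suc p) ≡ invFact p
  ι-invFact p = trans (rearr (ι (suc p)) (invFact p) (+ 1 / suc p))
               (trans (cong (_* invFact p) (ι-recip p)) (ℚ.*-identityˡ (invFact p)))
    where
    rearr : ∀ x y z → x * (y * z) ≡ (x * z) * y
    rearr = solve-∀ ℚ-ring

  invFact-0 : invFact 0 ≡ 1ℚ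
  invFact-0 = refl

  invFact-pos : ∀ p → Positive (invFact p)
  invFact-pos zero    = _
  invFact-pos (suc p) = ℚ.pos*pos⇒pos (invFact p) {{invFact-pos p}} (+ 1 / suc p) {{ℚ.normalize-pos 1 (suc p)}}

ι!-invFact : ∀ p → ι (p !) * invFact p ≡ 1ℚ
ι!-invFact zero    = cong₂ _*_ (fromℤ-/1 (+ 1)) invFact-0
ι!-invFact (suc p) = begin
  ι (suc p ℕ.* p !) * invFact (suc p)       ≡⟨ cong (_* invFact (suc p)) (ι-* (suc p) (p !)) ⟩
  (ι (suc p) * ι (p !)) * invFact (suc p)   ≡⟨ rearr (ι (suc p)) (ι (p !)) (invFact (suc p)) ⟩
  ι (p !) * (ι (suc p) * invFact (suc p))   ≡⟨ cong (ι (p !) *_) (ι-invFact p) ⟩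
  ι (p !) * invFact p                       ≡⟨ ι!-invFact p ⟩
  1ℚ                                        ∎
  where
  open ≡-Reasoning
  rearr : ∀ x y z → (x * y) * z ≡ y * (x * z)
  rearr = solve-∀ ℚ-ring

binomial-invFact : ∀ j l → ι ((j ℕ.+ l) C j) * invFact (j ℕ.+ l) ≡ invFact j * invFact l
binomial-invFact j l = begin
  ι ((j ℕ.+ l) C j) * invFact (j ℕ.+ l)
    ≡⟨ rearr₁ (ι ((j ℕ.+ l) C j)) (invFact (j ℕ.+ l)) ⟩
  ι ((j ℕ.+ l) C j) * invFact (j ℕ.+ l) * (1ℚ * 1ℚ)
    ≡⟨ cong (ι ((j ℕ.+ l) C j) * invFact (j ℕ.+ l) *_) (cong₂ _*_ (ι!-invFact j) (ι!-invFact l)) ⟨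
  ι ((j ℕ.+ l) C j) * invFact (j ℕ.+ l) * ((ι (j !) * invFact j) * (ι (l !) * invFact l))
    ≡⟨ rearr₂ (ι ((j ℕ.+ l) C j)) (invFact (j ℕ.+ l)) (ι (j !)) (invFact j) (ι (l !)) (invFact l) ⟩
  ι ((j ℕ.+ l) C j) * (ι (j !) * ι (l !)) * invFact (j ℕ.+ l) * (invFact j * invFact l)
    ≡⟨ cong (λ x → x * invFact (j ℕ.+ l) * (invFact j * invFact l)) numerator ⟩
  ι ((j ℕ.+ l) !) * invFact (j ℕ.+ l) * (invFact j * invFact l)
    ≡⟨ cong (_* (invFact j * invFact l)) (ι!-invFact (j ℕ.+ l)) ⟩
  1ℚ * (invFact j * invFact l)
    ≡⟨ ℚ.*-identityˡ _ ⟩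
  invFact j * invFact l ∎
  where
  open ≡-Reasoning
  instance _ = j ℕ.!* (j ℕ.+ l ∸ j) !≢0
  rearr₁ : ∀ x y → x * y ≡ x * y * (1ℚ * 1ℚ)
  rearr₁ = solve-∀ ℚ-ring
  rearr₂ : ∀ x y z u v w → x * y * ((z * u) * (v * w)) ≡ x * (z * v) * y * (u * w)
  rearr₂ = solve-∀ ℚ-ring
  j≤j+l = ℕ.m≤m+n j l
  factorials : ((j ℕ.+ l) C j) ℕ.* (j ! ℕ.* l !) ≡ (j ℕ.+ l) !
  factorials = begin
    ((j ℕ.+ l) C j) ℕ.* (j ! ℕ.* l !)
      ≡⟨ cong (λ x → ((j ℕ.+ l) C j) ℕ.* (j ! ℕ.* x !)) (ℕ.m+n∸m≡n j l) ⟨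
    ((j ℕ.+ l) C j) ℕ.* (j ! ℕ.* (j ℕ.+ l ∸ j) !)
      ≡⟨ cong (ℕ._* (j ! ℕ.* (j ℕ.+ l ∸ j) !)) (nCk≡n!/k![n-k]! j≤j+l) ⟩
    ((j ℕ.+ l) ! ℕ./ (j ! ℕ.* (j ℕ.+ l ∸ j) !)) ℕ.* (j ! ℕ.* (j ℕ.+ l ∸ j) !)
      ≡⟨ m/n*n≡m (k![n∸k]!∣n! j≤j+l) ⟩
    (j ℕ.+ l) ! ∎
  numerator : ι ((j ℕ.+ l) C j) * (ι (j !) * ι (l !)) ≡ ι ((j ℕ.+ l) !)
  numerator = begin
    ι ((j ℕ.+ l) C j) * (ι (j !) * ι (l !))  ≡⟨ cong (ι ((j ℕ.+ l) C j) *_) (ι-* (j !) (l !)) ⟨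
    ι ((j ℕ.+ l) C j) * ι (j ! ℕ.* l !)      ≡⟨ ι-* ((j ℕ.+ l) C j) (j ! ℕ.* l !) ⟨
    ι (((j ℕ.+ l) C j) ℕ.* (j ! ℕ.* l !))    ≡⟨ cong ι factorials ⟩
    ι ((j ℕ.+ l) !)                          ∎

-- Flag numbers of the Boolean lattice

sumFilter : {A : Set} → (A → Bool) → (A → ℕ) → List A → ℕ
sumFilter p g xs = sumℕ (map g (filterᵇ p xs))

sumFilter-++ : {A : Set} (p : A → Bool) (g : A → ℕ) (xs ys : List A) →
  sumFilter p g (xs ++ ys) ≡ sumFilter p g xs ℕ.+ sumFilter p g ys
sumFilter-++ p g []       ys = refl
sumFilter-++ p g (x ∷ xs) ys with p x
... | true  = trans (cong (g x ℕ.+_) (sumFilter-++ p g xs ys)) (sym (ℕ.+-assoc (g x) _ _))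
... | false = sumFilter-++ p g xs ys

sumFilter-map : {A B : Set} (p : B → Bool) (g : B → ℕ) (f : A → B) (xs : List A) →
  sumFilter p g (map f xs) ≡ sumFilter (p ∘ f) (g ∘ f) xs
sumFilter-map p g f []       = refl
sumFilter-map p g f (x ∷ xs) with p (f x)
... | true  = cong (g (f x) ℕ.+_) (sumFilter-map p g f xs)
... | false = sumFilter-map p g f xs

sumFilter-none : {A : Set} (p : A → Bool) (g : A → ℕ) → (∀ x → p x ≡ false) →
  ∀ xs → sumFilter p g xs ≡ 0
sumFilter-none p g none []       = refl
sumFilter-none p g none (x ∷ xs) with p x | none x
... | false | refl = sumFilter-none p g none xs

zeros : List Bool → ℕ
zeros []          = 0
zeros (true ∷ y)  = zeros y
zeros (false ∷ y) = suc (zeros y)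

card+zeros : ∀ y → card y ℕ.+ zeros y ≡ length y
card+zeros []          = refl
card+zeros (true ∷ y)  = cong suc (card+zeros y)
card+zeros (false ∷ y) = trans (ℕ.+-suc (card y) (zeros y)) (cong suc (card+zeros y))

supersets : List Bool → ℕ → ℕ
supersets []          zero    = 1
supersets []          (suc s) = 0
supersets (true ∷ y)  zero    = 0
supersets (true ∷ y)  (suc s) = supersets y s
supersets (false ∷ y) zero    = supersets y zero
supersets (false ∷ y) (suc s) = supersets y s ℕ.+ supersets y (suc s)

supersets-< : ∀ y {s} → s ℕ.< card y → supersets y s ≡ 0
supersets-< (true ∷ y)  {zero}  s<y       = refl
supersets-< (true ∷ y)  {suc s} (s≤s s<y) = supersets-< y s<y
supersets-< (false ∷ y) {zero}  s<y       = supersets-< y s<y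
supersets-< (false ∷ y) {suc s} s<y       =
  cong₂ ℕ._+_ (supersets-< y (ℕ.<-trans (ℕ.n<1+n s) s<y)) (supersets-< y s<y)

supersets-C : ∀ y j → supersets y (card y ℕ.+ j) ≡ zeros y C j
supersets-C []          zero    = refl
supersets-C []          (suc j) = refl
supersets-C (true ∷ y)  j       = supersets-C y j
supersets-C (false ∷ y) zero    with card y in eq | supersets-C y zero
... | zero  | h = h
... | suc k | h = trans (cong₂ ℕ._+_ (supersets-< y (ℕ.≤-reflexive (trans (cong suc (ℕ.+-identityʳ k)) (sym eq)))) h) refl
supersets-C (false ∷ y) (suc j) rewrite ℕ.+-suc (card y) j =
  trans (cong₂ ℕ._+_ (supersets-C y j) (trans (cong (supersets y) (sym (ℕ.+-suc (card y) j))) (supersets-C y (suc j))))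
        (nCk+nC[k+1]≡[n+1]C[k+1] (zeros y) j)

aboveᵇ : List Bool → ℕ → List Bool → Bool
aboveᵇ y s x = (y ⊆ᵇ x) ∧ (card x ≡ᵇ s)

-- The induction on chains knows `g x` only after multiplication by a normalising factor `u`, so the
-- constancy of `g` on sets of size `s` is assumed in the form `ι (g x) * u ≡ K`.
sumFilter-supersets : ∀ y s (g : List Bool → ℕ) u K →
  (∀ x → length x ≡ length y → card x ≡ s → ι (g x) * u ≡ K) →
  ι (sumFilter (aboveᵇ y s) g (allSubsets (length y))) * u ≡ ι (supersets y s) * K
sumFilter-supersets [] zero g u K h = begin
  ι (g [] ℕ.+ 0) * u   ≡⟨ cong (λ n → ι n * u) (ℕ.+-identityʳ (g [])) ⟩
  ι (g []) * u         ≡⟨ h [] refl refl ⟩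
  K                    ≡⟨ ℚ.*-identityˡ K ⟨
  1ℚ * K               ≡⟨ cong (_* K) (fromℤ-/1 (+ 1)) ⟨
  ι 1 * K              ∎
  where open ≡-Reasoning
sumFilter-supersets [] (suc s) g u K h = begin
  ι 0 * u   ≡⟨ cong (_* u) (fromℤ-/1 (+ 0)) ⟩
  0ℚ * u    ≡⟨ ℚ.*-zeroˡ u ⟩
  0ℚ        ≡⟨ ℚ.*-zeroˡ K ⟨
  0ℚ * K    ≡⟨ cong (_* K) (fromℤ-/1 (+ 0)) ⟨
  ι 0 * K   ∎
  where open ≡-Reasoning
sumFilter-supersets (b ∷ y) s g u K h = begin
  ι (sumFilter (aboveᵇ (b ∷ y) s) g (map (true ∷_) A ++ map (false ∷_) A)) * u
    ≡⟨ cong (λ n → ι n * u) (trans (sumFilter-++ (aboveᵇ (b ∷ y) s) g (map (true ∷_) A) (map (false ∷_) A))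
         (cong₂ ℕ._+_ (sumFilter-map (aboveᵇ (b ∷ y) s) g (true ∷_) A) (sumFilter-map (aboveᵇ (b ∷ y) s) g (false ∷_) A))) ⟩
  ι (part b true ℕ.+ part b false) * u
    ≡⟨ split b s refl h ⟩
  ι (supersets (b ∷ y) s) * K ∎
  where
  open ≡-Reasoning
  A = allSubsets (length y)
  part : Bool → Bool → ℕ
  part b b′ = sumFilter (aboveᵇ (b ∷ y) s ∘ (b′ ∷_)) (g ∘ (b′ ∷_)) A
  split : ∀ b s′ → s′ ≡ s → (∀ x → length x ≡ suc (length y) → card x ≡ s → ι (g x) * u ≡ K) →
    ι (part b true ℕ.+ part b false) * u ≡ ι (supersets (b ∷ y) s′) * K
  split true zero refl h
    rewrite sumFilter-none (aboveᵇ (true ∷ y) 0 ∘ (true ∷_)) (g ∘ (true ∷_)) (λ x → ∧-zeroʳ (y ⊆ᵇ x)) A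
          | sumFilter-none (aboveᵇ (true ∷ y) 0 ∘ (false ∷_)) (g ∘ (false ∷_)) (λ x → refl) A
          | fromℤ-/1 (+ 0) = trans (ℚ.*-zeroˡ u) (sym (ℚ.*-zeroˡ K))
  split true (suc s′) refl h
    rewrite sumFilter-none (aboveᵇ (true ∷ y) s ∘ (false ∷_)) (g ∘ (false ∷_)) (λ x → refl) A
          | ℕ.+-identityʳ (sumFilter (aboveᵇ y s′) (g ∘ (true ∷_)) A)
          = sumFilter-supersets y s′ (g ∘ (true ∷_)) u K (λ x l k → h (true ∷ x) (cong suc l) (cong suc k))
  split false zero refl h
    rewrite sumFilter-none (aboveᵇ (false ∷ y) 0 ∘ (true ∷_)) (g ∘ (true ∷_)) (λ x → ∧-zeroʳ (y ⊆ᵇ x)) A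
          = sumFilter-supersets y 0 (g ∘ (false ∷_)) u K (λ x l k → h (false ∷ x) (cong suc l) k)
  split false (suc s′) refl h = begin
    ι (part false true ℕ.+ part false false) * u
      ≡⟨ cong (_* u) (ι-+ (part false true) (part false false)) ⟩
    (ι (part false true) + ι (part false false)) * u
      ≡⟨ ℚ.*-distribʳ-+ u (ι (part false true)) (ι (part false false)) ⟩
    ι (part false true) * u + ι (part false false) * u
      ≡⟨ cong₂ _+_ (sumFilter-supersets y s′ (g ∘ (true ∷_)) u K (λ x l k → h (true ∷ x) (cong suc l) (cong suc k)))
                   (sumFilter-supersets y (suc s′) (g ∘ (false ∷_)) u K (λ x l k → h (false ∷ x) (cong suc l) k)) ⟩
    ι (supersets y s′) * K + ι (supersets y (suc s′)) * K
      ≡⟨ ℚ.*-distribʳ-+ K (ι (supersets y s′)) (ι (supersets y (suc s′))) ⟨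
    (ι (supersets y s′) + ι (supersets y (suc s′))) * K
      ≡⟨ cong (_* K) (ι-+ (supersets y s′) (supersets y (suc s′))) ⟨
    ι (supersets y s′ ℕ.+ supersets y (suc s′)) * K ∎

-- f_T(B_{r+1}) / (r+1)! is the product of 1/g! over the gaps g between consecutive ranks of the chain,
-- 0̂ and 1̂ included; p is the gap reached so far.
φ : ℕ → List Bool → ℚ
φ p []          = invFact p
φ p (true ∷ T)  = invFact p * φ 1 T
φ p (false ∷ T) = φ (suc p) T

-- If l zeros remain after the next choice, the next set can be chosen in C(p+l, p) ways, and C(p+l,
-- p) / (p+l)! = 1/p! · 1/l!. The first factor closes the gap p, the second is the normalisation
-- required by the chains above the chosen set.
chainsAbove-φ : ∀ T m k p y → length y ≡ m → card y ℕ.+ p ≡ k → k ℕ.+ length T ≡ m →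
  ι (chainsAbove m y (positionsFrom k T)) * invFact (zeros y) ≡ φ p T
chainsAbove-φ [] m k p y |y|≡m y+p≡k k+|T|≡m = begin
  ι 1 * invFact (zeros y)   ≡⟨ cong (_* invFact (zeros y)) (fromℤ-/1 (+ 1)) ⟩
  1ℚ * invFact (zeros y)    ≡⟨ ℚ.*-identityˡ (invFact (zeros y)) ⟩
  invFact (zeros y)         ≡⟨ cong invFact (ℕ.+-cancelˡ-≡ (card y) (zeros y) p (trans (card+zeros y) (trans |y|≡m (trans (sym k+|T|≡m) (trans (ℕ.+-identityʳ k) (sym y+p≡k)))))) ⟩
  invFact p                 ∎
  where open ≡-Reasoning
chainsAbove-φ (false ∷ T) m k p y |y|≡m y+p≡k k+|T|≡m =
  chainsAbove-φ T m (suc k) (suc p) y |y|≡m (trans (ℕ.+-suc (card y) p) (cong suc y+p≡k)) (trans (sym (ℕ.+-suc k (length T))) k+|T|≡m)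
chainsAbove-φ (true ∷ T) .(length y) .(card y ℕ.+ p) p y refl refl k+|T|≡m = begin
  ι (sumFilter (aboveᵇ y k) g (allSubsets (length y))) * iz
    ≡⟨ ℚ.*-identityʳ _ ⟨
  ι (sumFilter (aboveᵇ y k) g (allSubsets (length y))) * iz * 1ℚ
    -- Inserting l! · 1/l! supplies the factor under which the inner chain count is known.
    ≡⟨ cong (ι (sumFilter (aboveᵇ y k) g (allSubsets (length y))) * iz *_) (ι!-invFact l) ⟨
  ι (sumFilter (aboveᵇ y k) g (allSubsets (length y))) * iz * (ι (l !) * invFact l)
    ≡⟨ rearr₁ (ι (sumFilter (aboveᵇ y k) g (allSubsets (length y)))) iz (ι (l !)) (invFact l) ⟩
  (ι (sumFilter (aboveᵇ y k) g (allSubsets (length y))) * invFact l) * (iz * ι (l !))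
    ≡⟨ cong (_* (iz * ι (l !))) (sumFilter-supersets y k g (invFact l) (φ 1 T) step) ⟩
  (ι (supersets y k) * φ 1 T) * (iz * ι (l !))
    ≡⟨ cong (λ n → (ι n * φ 1 T) * (iz * ι (l !))) (supersets-C y p) ⟩
  (ι (zeros y C p) * φ 1 T) * (iz * ι (l !))
    ≡⟨ rearr₂ (ι (zeros y C p)) (φ 1 T) iz (ι (l !)) ⟩
  (ι (zeros y C p) * iz) * (φ 1 T * ι (l !))
    ≡⟨ cong (λ n → (ι (n C p) * invFact n) * (φ 1 T * ι (l !))) zeros≡p+l ⟩
  (ι ((p ℕ.+ l) C p) * invFact (p ℕ.+ l)) * (φ 1 T * ι (l !))
    ≡⟨ cong (_* (φ 1 T * ι (l !))) (binomial-invFact p l) ⟩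
  (invFact p * invFact l) * (φ 1 T * ι (l !))
    ≡⟨ rearr₃ (invFact p) (invFact l) (φ 1 T) (ι (l !)) ⟩
  (invFact p * φ 1 T) * (ι (l !) * invFact l)
    ≡⟨ cong ((invFact p * φ 1 T) *_) (ι!-invFact l) ⟩
  (invFact p * φ 1 T) * 1ℚ
    ≡⟨ ℚ.*-identityʳ _ ⟩
  invFact p * φ 1 T ∎
  where
  open ≡-Reasoning
  k = card y ℕ.+ p
  l = suc (length T)
  iz = invFact (zeros y)
  g : List Bool → ℕ
  g x = chainsAbove (length y) x (positionsFrom (suc k) T)
  rearr₁ : ∀ x y z w → x * y * (z * w) ≡ (x * w) * (y * z)
  rearr₁ = solve-∀ ℚ-ring
  rearr₂ : ∀ x y z w → (x * y) * (z * w) ≡ (x * z) * (y * w)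
  rearr₂ = solve-∀ ℚ-ring
  rearr₃ : ∀ x y z w → (x * y) * (z * w) ≡ (x * z) * (w * y)
  rearr₃ = solve-∀ ℚ-ring
  zeros≡p+l : zeros y ≡ p ℕ.+ l
  zeros≡p+l = ℕ.+-cancelˡ-≡ (card y) (zeros y) (p ℕ.+ l)
    (trans (card+zeros y) (trans (sym k+|T|≡m) (ℕ.+-assoc (card y) p l)))
  step : ∀ x → length x ≡ length y → card x ≡ k → ι (g x) * invFact l ≡ φ 1 T
  step x |x|≡|y| |x|≡k = trans
    (cong (λ n → ι (g x) * invFact n) (ℕ.+-cancelˡ-≡ k l (zeros x)
      (trans k+|T|≡m (trans (sym |x|≡|y|) (trans (sym (card+zeros x)) (cong (ℕ._+ zeros x) |x|≡k))))))
    (chainsAbove-φ T (length y) (suc k) 1 x |x|≡|y| (trans (ℕ.+-comm (card x) 1) (cong suc |x|≡k))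
      (trans (sym (ℕ.+-suc k (length T))) k+|T|≡m))

card-∅ : ∀ m → card (replicate m false) ≡ 0
card-∅ zero    = refl
card-∅ (suc m) = card-∅ m

zeros-∅ : ∀ m → zeros (replicate m false) ≡ m
zeros-∅ zero    = refl
zeros-∅ (suc m) = cong suc (zeros-∅ m)

fB-φ : ∀ T → ι (fB T) * invFact (suc (length T)) ≡ φ 1 T
fB-φ T = trans (cong (λ n → ι (fB T) * invFact n) (sym (zeros-∅ m)))
  (chainsAbove-φ T m 1 1 (replicate m false) (length-replicate m) (cong (ℕ._+ 1) (card-∅ m)) refl)
  where m = suc (length T)

-- The Riccati equation for ab-words

-- η 1 w = h_w(B_{r+1}) / (r+1)!, and η p w = η 1 (aᵖ⁻¹ w).
η : ℕ → List Bool → ℚ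
η p []          = invFact p
η p (false ∷ w) = η (suc p) w
η p (true ∷ w)  = invFact p * η 1 w - η (suc p) w

sumℤ-++ : {A B C : Set} (F : C → ℤ) (f : A → C) (g : B → C) (xs : List A) (ys : List B) →
  sumℤ (map F (map f xs ++ map g ys)) ≡ sumℤ (map (F ∘ f) xs) ℤ.+ sumℤ (map (F ∘ g) ys)
sumℤ-++ F f g []       []       = refl
sumℤ-++ F f g []       (y ∷ ys) =
  trans (cong (λ k → F (g y) ℤ.+ k) (sumℤ-++ F f g [] ys)) (rearr (F (g y)) (sumℤ (map (F ∘ g) ys)))
  where
  rearr : ∀ i j → i ℤ.+ (+ 0 ℤ.+ j) ≡ + 0 ℤ.+ (i ℤ.+ j)
  rearr i j = trans (cong (λ k → i ℤ.+ k) (ℤ.+-identityˡ j)) (sym (ℤ.+-identityˡ (i ℤ.+ j)))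
sumℤ-++ F f g (x ∷ xs) ys       =
  trans (cong (λ k → F (f x) ℤ.+ k) (sumℤ-++ F f g xs ys)) (sym (ℤ.+-assoc (F (f x)) _ _))

sumℤ-map : {A C : Set} (F : C → ℤ) (f : A → C) (xs : List A) → sumℤ (map F (map f xs)) ≡ sumℤ (map (F ∘ f) xs)
sumℤ-map F f xs = cong sumℤ (sym (map-∘ xs))

sign : ℕ → ℤ
sign k = (ℤ.- (+ 1)) ℤ.^ k

fromℤ-sign-suc : ∀ k → fromℤ (sign (suc k)) ≡ - fromℤ (sign k)
fromℤ-sign-suc k = begin
  fromℤ (sign (suc k))                 ≡⟨ fromℤ-* (ℤ.- (+ 1)) (sign k) ⟩
  fromℤ (ℤ.- (+ 1)) * fromℤ (sign k)      ≡⟨ cong (_* fromℤ (sign k)) (fromℤ-/1 (ℤ.- (+ 1))) ⟩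
  (- 1ℚ) * fromℤ (sign k)              ≡⟨ neg (fromℤ (sign k)) ⟩
  - fromℤ (sign k)                     ∎
  where
  open ≡-Reasoning
  neg : ∀ x → (- 1ℚ) * x ≡ - x
  neg = solve-∀ ℚ-ring

-- The accumulator `K` lets the induction close: keeping the first element of S in T closes a gap
-- and turns `K` into `K * invFact p`; dropping it flips the sign, so `K` becomes `- K` while the
-- gap grows.
signedSum-η : ∀ S p (F : List Bool → ℤ) u K →
  (∀ T → length T ≡ length S → card T ℕ.≤ card S →
    fromℤ (F T) * u ≡ K * (fromℤ (sign (card S ∸ card T)) * φ p T)) →
  fromℤ (sumℤ (map F (subsetsOf S))) * u ≡ K * η p S
signedSum-η [] p F u K h = begin
  fromℤ (F [] ℤ.+ + 0) * u              ≡⟨ cong (λ i → fromℤ i * u) (ℤ.+-identityʳ (F [])) ⟩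
  fromℤ (F []) * u                      ≡⟨ h [] refl z≤n ⟩
  K * (fromℤ (+ 1) * invFact p)         ≡⟨ cong (λ x → K * (x * invFact p)) (fromℤ-/1 (+ 1)) ⟩
  K * (1ℚ * invFact p)               ≡⟨ cong (K *_) (ℚ.*-identityˡ (invFact p)) ⟩
  K * invFact p                      ∎
  where open ≡-Reasoning
signedSum-η (false ∷ S) p F u K h = trans
  (cong (λ i → fromℤ i * u) (sumℤ-map F (false ∷_) (subsetsOf S)))
  (signedSum-η S (suc p) (F ∘ (false ∷_)) u K (λ T l k → h (false ∷ T) (cong suc l) k))
signedSum-η (true ∷ S) p F u K h = begin
  fromℤ (sumℤ (map F (map (true ∷_) (subsetsOf S) ++ map (false ∷_) (subsetsOf S)))) * u
    ≡⟨ cong (λ i → fromℤ i * u) (sumℤ-++ F (true ∷_) (false ∷_) (subsetsOf S) (subsetsOf S)) ⟩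
  fromℤ (s₁ ℤ.+ s₂) * u
    ≡⟨ cong (_* u) (fromℤ-+ s₁ s₂) ⟩
  (fromℤ s₁ + fromℤ s₂) * u
    ≡⟨ ℚ.*-distribʳ-+ u (fromℤ s₁) (fromℤ s₂) ⟩
  fromℤ s₁ * u + fromℤ s₂ * u
    ≡⟨ cong₂ _+_ (signedSum-η S 1 (F ∘ (true ∷_)) u (K * invFact p) h₁)
                 (signedSum-η S (suc p) (F ∘ (false ∷_)) u (- K) h₂) ⟩
  (K * invFact p) * η 1 S + (- K) * η (suc p) S
    ≡⟨ rearr₃ K (invFact p) (η 1 S) (η (suc p) S) ⟩
  K * (invFact p * η 1 S - η (suc p) S) ∎
  where
  open ≡-Reasoning
  s₁ = sumℤ (map (F ∘ (true ∷_)) (subsetsOf S))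
  s₂ = sumℤ (map (F ∘ (false ∷_)) (subsetsOf S))
  rearr₁ : ∀ k s i t → k * (s * (i * t)) ≡ (k * i) * (s * t)
  rearr₁ = solve-∀ ℚ-ring
  rearr₂ : ∀ k s t → k * ((- s) * t) ≡ (- k) * (s * t)
  rearr₂ = solve-∀ ℚ-ring
  rearr₃ : ∀ k i s t → (k * i) * s + (- k) * t ≡ k * (i * s - t)
  rearr₃ = solve-∀ ℚ-ring
  h₁ : ∀ T → length T ≡ length S → card T ℕ.≤ card S →
    fromℤ (F (true ∷ T)) * u ≡ (K * invFact p) * (fromℤ (sign (card S ∸ card T)) * φ 1 T)
  h₁ T l k = trans (h (true ∷ T) (cong suc l) (s≤s k)) (rearr₁ K (fromℤ (sign (card S ∸ card T))) (invFact p) (φ 1 T))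
  h₂ : ∀ T → length T ≡ length S → card T ℕ.≤ card S →
    fromℤ (F (false ∷ T)) * u ≡ (- K) * (fromℤ (sign (card S ∸ card T)) * φ (suc p) T)
  h₂ T l k = begin
    fromℤ (F (false ∷ T)) * u
      ≡⟨ h (false ∷ T) (cong suc l) (ℕ.≤-trans k (ℕ.n≤1+n _)) ⟩
    K * (fromℤ (sign (suc (card S) ∸ card T)) * φ (suc p) T)
      -- Here `card T ≤ card S` matters: the truncated difference increases by one, and the sign
      -- flips, only because nothing is cut off.
      ≡⟨ cong (λ n → K * (fromℤ (sign n) * φ (suc p) T)) (ℕ.+-∸-assoc 1 k) ⟩
    K * (fromℤ (sign (suc (card S ∸ card T))) * φ (suc p) T)
      ≡⟨ cong (λ x → K * (x * φ (suc p) T)) (fromℤ-sign-suc (card S ∸ card T)) ⟩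
    K * ((- fromℤ (sign (card S ∸ card T))) * φ (suc p) T)
      ≡⟨ rearr₂ K (fromℤ (sign (card S ∸ card T))) (φ (suc p) T) ⟩
    (- K) * (fromℤ (sign (card S ∸ card T)) * φ (suc p) T) ∎

hB-η : ∀ S → fromℤ (hB S) * invFact (suc (length S)) ≡ η 1 S
hB-η S = trans (signedSum-η S 1 (λ T → sign (card S ∸ card T) ℤ.* (+ fB T)) (invFact (suc (length S))) 1ℚ term)
               (ℚ.*-identityˡ (η 1 S))
  where
  open ≡-Reasoning
  term : ∀ T → length T ≡ length S → card T ℕ.≤ card S →
    fromℤ (sign (card S ∸ card T) ℤ.* (+ fB T)) * invFact (suc (length S))
      ≡ 1ℚ * (fromℤ (sign (card S ∸ card T)) * φ 1 T)
  term T l k = begin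
    fromℤ (sign (card S ∸ card T) ℤ.* (+ fB T)) * invFact (suc (length S))
      ≡⟨ cong₂ _*_ (fromℤ-* (sign (card S ∸ card T)) (+ fB T)) (cong (invFact ∘ suc) (sym l)) ⟩
    (fromℤ (sign (card S ∸ card T)) * ι (fB T)) * invFact (suc (length T))
      ≡⟨ ℚ.*-assoc (fromℤ (sign (card S ∸ card T))) (ι (fB T)) (invFact (suc (length T))) ⟩
    fromℤ (sign (card S ∸ card T)) * (ι (fB T) * invFact (suc (length T)))
      ≡⟨ cong (fromℤ (sign (card S ∸ card T)) *_) (fB-φ T) ⟩
    fromℤ (sign (card S ∸ card T)) * φ 1 T
      ≡⟨ ℚ.*-identityˡ _ ⟨
    1ℚ * (fromℤ (sign (card S ∸ card T)) * φ 1 T) ∎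

-- Factorisations of an ab-word at one letter

δ : Bool → Bool → ℚ
δ false false = 0ℚ
δ false true  = 1ℚ
δ true  false = 1ℚ
δ true  true  = 0ℚ

-- Σ Y(x) k(s, y) over the factorisations w = x s y with a letter s.
splits : (Bool → List Bool → ℚ) → (List Bool → ℚ) → List Bool → ℚ
splits k Y []      = 0ℚ
splits k Y (s ∷ w) = k s w * Y [] + splits k (Y ∘ (s ∷_)) w

splits-linear : ∀ k a b {X Y Z : List Bool → ℚ} → (∀ w → X w ≡ a * Y w + b * Z w) →
  ∀ w → splits k X w ≡ a * splits k Y w + b * splits k Z w
splits-linear k a b h []      = zeros-lin a b
  where
  zeros-lin : ∀ a b → 0ℚ ≡ a * 0ℚ + b * 0ℚ
  zeros-lin = solve-∀ ℚ-ring
splits-linear k a b {X} {Y} {Z} h (s ∷ w) = trans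
  (cong₂ (λ x y → k s w * x + y) (h []) (splits-linear k a b (λ w → h (s ∷ w)) w))
  (rearr (k s w) a b (Y []) (Z []) (splits k (Y ∘ (s ∷_)) w) (splits k (Z ∘ (s ∷_)) w))
  where
  rearr : ∀ k a b y z u v → k * (a * y + b * z) + (a * u + b * v) ≡ a * (k * y + u) + b * (k * z + v)
  rearr = solve-∀ ℚ-ring

splits-sub : ∀ k a (Y Z : List Bool → ℚ) w → splits k (λ x → a * Y x - Z x) w ≡ a * splits k Y w - splits k Z w
splits-sub k a Y Z w = trans
  (splits-linear k a (- 1ℚ) (λ w → minus a (Y w) (Z w)) w)
  (sym (minus a (splits k Y w) (splits k Z w)))
  where
  minus : ∀ a y z → a * y - z ≡ a * y + (- 1ℚ) * z
  minus = solve-∀ ℚ-ring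

splits-+ : ∀ k l m Y → (∀ s w → k s w + l s w ≡ m s w) → ∀ w → splits k Y w + splits l Y w ≡ splits m Y w
splits-+ k l m Y h []      = refl
splits-+ k l m Y h (s ∷ w) = trans
  (rearr (k s w) (l s w) (Y []) (splits k (Y ∘ (s ∷_)) w) (splits l (Y ∘ (s ∷_)) w))
  (cong₂ (λ x y → x * Y [] + y) (h s w) (splits-+ k l m (Y ∘ (s ∷_)) h w))
  where
  rearr : ∀ k l y u v → (k * y + u) + (l * y + v) ≡ (k + l) * y + (u + v)
  rearr = solve-∀ ℚ-ring

-- The coefficient of an ab-word in 1 + bE. Its counterpart for 1 + aE is `η 0`, which vanishes on
-- words beginning with b because 0! = 1.
peak : List Bool → ℚ
peak []          = 1ℚ
peak (true ∷ w)  = η 1 w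
peak (false ∷ w) = 0ℚ

-- For a factorisation x s y with x taken from E, these are the coefficients of s y in a(1 + bE), in
-- b(1 + aE), and in their sum c + dE.
maxKernel minKernel kernel : Bool → List Bool → ℚ
maxKernel false w = peak w
maxKernel true  w = 0ℚ
minKernel false w = 0ℚ
minKernel true  w = η 0 w
kernel s []      = 1ℚ
kernel s (t ∷ w) = δ s t * η 1 w

-- The coefficient of aᵠ w in E′ = (1 + Ea)(1 + bE).
η-max : ∀ q w → ι (suc q ℕ.+ length w) * η (suc q) w ≡ invFact q * peak w + splits maxKernel (η (suc q)) w
η-max q [] = begin
  ι (suc q ℕ.+ 0) * invFact (suc q)   ≡⟨ cong (λ n → ι n * invFact (suc q)) (ℕ.+-identityʳ (suc q)) ⟩
  ι (suc q) * invFact (suc q)         ≡⟨ ι-invFact q ⟩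
  invFact q                           ≡⟨ pad (invFact q) ⟩
  invFact q * 1ℚ + 0ℚ                 ∎
  where
  open ≡-Reasoning
  pad : ∀ x → x ≡ x * 1ℚ + 0ℚ
  pad = solve-∀ ℚ-ring
η-max q (false ∷ w) = begin
  ι (suc q ℕ.+ suc (length w)) * η (2 ℕ.+ q) w
    ≡⟨ cong (λ n → ι n * η (2 ℕ.+ q) w) (ℕ.+-suc (suc q) (length w)) ⟩
  ι (2 ℕ.+ q ℕ.+ length w) * η (2 ℕ.+ q) w
    ≡⟨ η-max (suc q) w ⟩
  invFact (suc q) * peak w + splits maxKernel (η (2 ℕ.+ q)) w
    ≡⟨ pad (invFact q) (invFact (suc q)) (peak w) (splits maxKernel (η (2 ℕ.+ q)) w) ⟩
  invFact q * 0ℚ + (peak w * invFact (suc q) + splits maxKernel (η (2 ℕ.+ q)) w) ∎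
  where
  open ≡-Reasoning
  pad : ∀ i j p s → j * p + s ≡ i * 0ℚ + (p * j + s)
  pad = solve-∀ ℚ-ring
η-max q (true ∷ w) = begin
  ι (suc q ℕ.+ suc (length w)) * (invFact (suc q) * η 1 w - η (2 ℕ.+ q) w)
    -- Leibniz rule: the weight of aᵠ b w is the sum of the weights q + 1 of aᵠ and |w| + 1 of w, so
    -- it distributes over the product; the subtracted word aᵠ⁺¹ w carries the same total weight.
    ≡⟨ cong (_* (invFact (suc q) * η 1 w - η (2 ℕ.+ q) w)) (ι-+ (suc q) (suc (length w))) ⟩
  (ι (suc q) + ι (suc (length w))) * (invFact (suc q) * η 1 w - η (2 ℕ.+ q) w)
    ≡⟨ rearr₁ (ι (suc q)) (ι (suc (length w))) (invFact (suc q)) (η 1 w) (η (2 ℕ.+ q) w) ⟩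
  (ι (suc q) * invFact (suc q)) * η 1 w + invFact (suc q) * (ι (suc (length w)) * η 1 w)
    - (ι (suc q) + ι (suc (length w))) * η (2 ℕ.+ q) w
    ≡⟨ cong₂ _-_ (cong₂ (λ x y → x * η 1 w + invFact (suc q) * y) (ι-invFact q) (trans (η-max 0 w) (cong (λ x → x * peak w + splits maxKernel (η 1) w) invFact-0)))
         (trans (cong (_* η (2 ℕ.+ q) w) (trans (sym (ι-+ (suc q) (suc (length w)))) (cong ι (ℕ.+-suc (suc q) (length w))))) (η-max (suc q) w)) ⟩
  invFact q * η 1 w + invFact (suc q) * (1ℚ * peak w + splits maxKernel (η 1) w)
    - (invFact (suc q) * peak w + splits maxKernel (η (2 ℕ.+ q)) w)
    ≡⟨ rearr₂ (invFact q) (invFact (suc q)) (η 1 w) (peak w) (splits maxKernel (η 1) w) (splits maxKernel (η (2 ℕ.+ q)) w) (η (suc q) []) ⟩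
  invFact q * η 1 w + (0ℚ * η (suc q) [] + (invFact (suc q) * splits maxKernel (η 1) w - splits maxKernel (η (2 ℕ.+ q)) w))
    ≡⟨ cong (λ x → invFact q * η 1 w + (0ℚ * η (suc q) [] + x)) (splits-sub maxKernel (invFact (suc q)) (η 1) (η (2 ℕ.+ q)) w) ⟨
  invFact q * η 1 w + (0ℚ * η (suc q) [] + splits maxKernel (η (suc q) ∘ (true ∷_)) w) ∎
  where
  open ≡-Reasoning
  rearr₁ : ∀ a b i x y → (a + b) * (i * x - y) ≡ (a * i) * x + i * (b * x) - (a + b) * y
  rearr₁ = solve-∀ ℚ-ring
  rearr₂ : ∀ i j x p s t y → i * x + j * (1ℚ * p + s) - (j * p + t) ≡ i * x + (0ℚ * y + (j * s - t))
  rearr₂ = solve-∀ ℚ-ring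

-- The coefficient of aᵠ w in E′ = (1 + Eb)(1 + aE).
η-min : ∀ q w → ι (suc q ℕ.+ length w) * η (suc q) w ≡ η q w + splits minKernel (η (suc q)) w
η-min q [] = begin
  ι (suc q ℕ.+ 0) * invFact (suc q)   ≡⟨ cong (λ n → ι n * invFact (suc q)) (ℕ.+-identityʳ (suc q)) ⟩
  ι (suc q) * invFact (suc q)         ≡⟨ ι-invFact q ⟩
  invFact q                           ≡⟨ ℚ.+-identityʳ (invFact q) ⟨
  invFact q + 0ℚ                      ∎
  where open ≡-Reasoning
η-min q (false ∷ w) = begin
  ι (suc q ℕ.+ suc (length w)) * η (2 ℕ.+ q) w
    ≡⟨ cong (λ n → ι n * η (2 ℕ.+ q) w) (ℕ.+-suc (suc q) (length w)) ⟩
  ι (2 ℕ.+ q ℕ.+ length w) * η (2 ℕ.+ q) w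
    ≡⟨ η-min (suc q) w ⟩
  η (suc q) w + splits minKernel (η (2 ℕ.+ q)) w
    ≡⟨ pad (η (suc q) w) (splits minKernel (η (2 ℕ.+ q)) w) (invFact (suc q)) ⟩
  η (suc q) w + (0ℚ * invFact (suc q) + splits minKernel (η (2 ℕ.+ q)) w) ∎
  where
  open ≡-Reasoning
  pad : ∀ x s j → x + s ≡ x + (0ℚ * j + s)
  pad = solve-∀ ℚ-ring
η-min q (true ∷ w) = begin
  ι (suc q ℕ.+ suc (length w)) * (invFact (suc q) * η 1 w - η (2 ℕ.+ q) w)
    ≡⟨ cong (_* (invFact (suc q) * η 1 w - η (2 ℕ.+ q) w)) (ι-+ (suc q) (suc (length w))) ⟩
  (ι (suc q) + ι (suc (length w))) * (invFact (suc q) * η 1 w - η (2 ℕ.+ q) w)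
    ≡⟨ rearr₁ (ι (suc q)) (ι (suc (length w))) (invFact (suc q)) (η 1 w) (η (2 ℕ.+ q) w) ⟩
  (ι (suc q) * invFact (suc q)) * η 1 w + invFact (suc q) * (ι (suc (length w)) * η 1 w)
    - (ι (suc q) + ι (suc (length w))) * η (2 ℕ.+ q) w
    ≡⟨ cong₂ _-_ (cong₂ (λ x y → x * η 1 w + invFact (suc q) * y) (ι-invFact q) (η-min 0 w))
         (trans (cong (_* η (2 ℕ.+ q) w) (trans (sym (ι-+ (suc q) (suc (length w)))) (cong ι (ℕ.+-suc (suc q) (length w))))) (η-min (suc q) w)) ⟩
  invFact q * η 1 w + invFact (suc q) * (η 0 w + splits minKernel (η 1) w)
    - (η (suc q) w + splits minKernel (η (2 ℕ.+ q)) w)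
    ≡⟨ rearr₂ (invFact q) (invFact (suc q)) (η 1 w) (η 0 w) (splits minKernel (η 1) w) (splits minKernel (η (2 ℕ.+ q)) w) (η (suc q) w) ⟩
  invFact q * η 1 w - η (suc q) w + (η 0 w * η (suc q) [] + (invFact (suc q) * splits minKernel (η 1) w - splits minKernel (η (2 ℕ.+ q)) w))
    ≡⟨ cong (λ x → invFact q * η 1 w - η (suc q) w + (η 0 w * η (suc q) [] + x)) (splits-sub minKernel (invFact (suc q)) (η 1) (η (2 ℕ.+ q)) w) ⟨
  invFact q * η 1 w - η (suc q) w + (η 0 w * η (suc q) [] + splits minKernel (η (suc q) ∘ (true ∷_)) w) ∎
  where
  open ≡-Reasoning
  rearr₁ : ∀ a b i x y → (a + b) * (i * x - y) ≡ (a * i) * x + i * (b * x) - (a + b) * y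
  rearr₁ = solve-∀ ℚ-ring
  rearr₂ : ∀ i j x z s t y → i * x + j * (z + s) - (y + t) ≡ i * x - y + (z * j + (j * s - t))
  rearr₂ = solve-∀ ℚ-ring

-- The coefficient of an ab-word in 2 + cE = (1 + bE) + (1 + aE).
ends : List Bool → ℚ
ends []      = 1ℚ + 1ℚ
ends (s ∷ w) = η 1 w

η-riccati : ∀ w → (1ℚ + 1ℚ) * (ι (suc (length w)) * η 1 w) ≡ ends w + splits kernel (η 1) w
η-riccati w = begin
  (1ℚ + 1ℚ) * (ι (suc (length w)) * η 1 w)
    ≡⟨ double (ι (suc (length w)) * η 1 w) ⟩
  ι (suc (length w)) * η 1 w + ι (suc (length w)) * η 1 w
    ≡⟨ cong₂ _+_ (trans (η-max 0 w) (cong (λ x → x * peak w + splits maxKernel (η 1) w) invFact-0)) (η-min 0 w) ⟩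
  (1ℚ * peak w + splits maxKernel (η 1) w) + (η 0 w + splits minKernel (η 1) w)
    ≡⟨ rearr (peak w) (η 0 w) (splits maxKernel (η 1) w) (splits minKernel (η 1) w) ⟩
  (peak w + η 0 w) + (splits maxKernel (η 1) w + splits minKernel (η 1) w)
    ≡⟨ cong₂ _+_ (peak+η₀ w) (splits-+ maxKernel minKernel kernel (η 1) max+min w) ⟩
  ends w + splits kernel (η 1) w ∎
  where
  open ≡-Reasoning
  double : ∀ x → (1ℚ + 1ℚ) * x ≡ x + x
  double = solve-∀ ℚ-ring
  rearr : ∀ a b s t → (1ℚ * a + s) + (b + t) ≡ (a + b) + (s + t)
  rearr = solve-∀ ℚ-ring
  cancel : ∀ x → 1ℚ * x - x ≡ 0ℚ
  cancel = solve-∀ ℚ-ring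
  η₀-true : ∀ w → η 0 (true ∷ w) ≡ 0ℚ
  η₀-true w = trans (cong (λ x → x * η 1 w - η 1 w) invFact-0) (cancel (η 1 w))
  peak+η₀ : ∀ w → peak w + η 0 w ≡ ends w
  peak+η₀ []          = cong (λ x → 1ℚ + x) invFact-0
  peak+η₀ (false ∷ w) = ℚ.+-identityˡ (η 1 w)
  peak+η₀ (true ∷ w)  = trans (cong (λ x → η 1 w + x) (η₀-true w)) (ℚ.+-identityʳ (η 1 w))
  max+min : ∀ s w → maxKernel s w + minKernel s w ≡ kernel s w
  max+min false []          = refl
  max+min false (false ∷ w) = trans (ℚ.+-identityˡ 0ℚ) (sym (ℚ.*-zeroˡ (η 1 w)))
  max+min false (true ∷ w)  = trans (ℚ.+-identityʳ (η 1 w)) (sym (ℚ.*-identityˡ (η 1 w)))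
  max+min true  []          = trans (ℚ.+-identityˡ (invFact 0)) invFact-0
  max+min true  (false ∷ w) = trans (ℚ.+-identityˡ (η 1 w)) (sym (ℚ.*-identityˡ (η 1 w)))
  max+min true  (true ∷ w)  = trans (ℚ.+-identityˡ _) (trans (η₀-true w) (sym (ℚ.*-zeroˡ (η 1 w))))

-- From ab-words to cd-words

length-sumℕ : {A : Set} (xs : List A) → length xs ≡ sumℕ (map (λ _ → 1) xs)
length-sumℕ []       = refl
length-sumℕ (x ∷ xs) = cong suc (length-sumℕ xs)

abCoeff-sumFilter : ∀ v w → abCoeff v w ≡ sumFilter (eqWord w) (λ _ → 1) (expand v)
abCoeff-sumFilter v w = length-sumℕ (filterᵇ (eqWord w) (expand v))

abCoeff-branch : ∀ {f g : List Bool → List Bool} v v′ w → expand v ≡ map f (expand v′) ++ map g (expand v′) →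
  abCoeff v w ≡ sumFilter (eqWord w ∘ f) (λ _ → 1) (expand v′) ℕ.+ sumFilter (eqWord w ∘ g) (λ _ → 1) (expand v′)
abCoeff-branch {f} {g} v v′ w eq = begin
  abCoeff v w
    ≡⟨ abCoeff-sumFilter v w ⟩
  sumFilter (eqWord w) (λ _ → 1) (expand v)
    ≡⟨ cong (sumFilter (eqWord w) (λ _ → 1)) eq ⟩
  sumFilter (eqWord w) (λ _ → 1) (map f (expand v′) ++ map g (expand v′))
    ≡⟨ sumFilter-++ (eqWord w) (λ _ → 1) (map f (expand v′)) (map g (expand v′)) ⟩
  sumFilter (eqWord w) (λ _ → 1) (map f (expand v′)) ℕ.+ sumFilter (eqWord w) (λ _ → 1) (map g (expand v′))
    ≡⟨ cong₂ ℕ._+_ (sumFilter-map (eqWord w) (λ _ → 1) f (expand v′)) (sumFilter-map (eqWord w) (λ _ → 1) g (expand v′)) ⟩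
  sumFilter (eqWord w ∘ f) (λ _ → 1) (expand v′) ℕ.+ sumFilter (eqWord w ∘ g) (λ _ → 1) (expand v′) ∎
  where open ≡-Reasoning

abCoeff-c : ∀ v s w → abCoeff (c ∷ v) (s ∷ w) ≡ abCoeff v w
abCoeff-c v false w = trans (abCoeff-branch (c ∷ v) v (false ∷ w) refl)
  (trans (cong (sumFilter (eqWord w) (λ _ → 1) (expand v) ℕ.+_) (sumFilter-none (λ _ → false) (λ _ → 1) (λ _ → refl) (expand v)))
  (trans (ℕ.+-identityʳ _) (sym (abCoeff-sumFilter v w))))
abCoeff-c v true w = trans (abCoeff-branch (c ∷ v) v (true ∷ w) refl)
  (trans (cong (ℕ._+ sumFilter (eqWord w) (λ _ → 1) (expand v)) (sumFilter-none (λ _ → false) (λ _ → 1) (λ _ → refl) (expand v)))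
  (sym (abCoeff-sumFilter v w)))

abCoeff-d : ∀ v s t w → ι (abCoeff (d ∷ v) (s ∷ t ∷ w)) ≡ δ s t * ι (abCoeff v w)
abCoeff-d v false false w = trans (cong ι (trans (abCoeff-branch (d ∷ v) v (false ∷ false ∷ w) refl)
  (cong₂ ℕ._+_ (sumFilter-none (λ _ → false) (λ _ → 1) (λ _ → refl) (expand v)) (sumFilter-none (λ _ → false) (λ _ → 1) (λ _ → refl) (expand v)))))
  (trans (fromℤ-/1 (+ 0)) (sym (ℚ.*-zeroˡ (ι (abCoeff v w)))))
abCoeff-d v true true w = trans (cong ι (trans (abCoeff-branch (d ∷ v) v (true ∷ true ∷ w) refl)
  (cong₂ ℕ._+_ (sumFilter-none (λ _ → false) (λ _ → 1) (λ _ → refl) (expand v)) (sumFilter-none (λ _ → false) (λ _ → 1) (λ _ → refl) (expand v)))))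
  (trans (fromℤ-/1 (+ 0)) (sym (ℚ.*-zeroˡ (ι (abCoeff v w)))))
abCoeff-d v false true w = trans (cong ι (trans (abCoeff-branch (d ∷ v) v (false ∷ true ∷ w) refl)
  (trans (cong (sumFilter (eqWord w) (λ _ → 1) (expand v) ℕ.+_) (sumFilter-none (λ _ → false) (λ _ → 1) (λ _ → refl) (expand v)))
  (trans (ℕ.+-identityʳ _) (sym (abCoeff-sumFilter v w))))))
  (sym (ℚ.*-identityˡ (ι (abCoeff v w))))
abCoeff-d v true false w = trans (cong ι (trans (abCoeff-branch (d ∷ v) v (true ∷ false ∷ w) refl)
  (trans (cong (ℕ._+ sumFilter (eqWord w) (λ _ → 1) (expand v)) (sumFilter-none (λ _ → false) (λ _ → 1) (λ _ → refl) (expand v)))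
  (sym (abCoeff-sumFilter v w)))))
  (sym (ℚ.*-identityˡ (ι (abCoeff v w))))

-- The coefficient of an ab-word in Σ_v x(v) v.
ev : (List CD → ℚ) → List Bool → ℚ
ev x []          = x []
ev x (s ∷ [])    = x (c ∷ [])
ev x (s ∷ t ∷ w) = ev (x ∘ (c ∷_)) (t ∷ w) + δ s t * ev (x ∘ (d ∷_)) w

ev-linear : ∀ a b {x y z : List CD → ℚ} → (∀ v → x v ≡ a * y v + b * z v) →
  ∀ w → ev x w ≡ a * ev y w + b * ev z w
ev-linear a b h []          = h []
ev-linear a b h (s ∷ [])    = h (c ∷ [])
ev-linear a b {x} {y} {z} h (s ∷ t ∷ w) = trans
  (cong₂ (λ p q → p + δ s t * q) (ev-linear a b (λ v → h (c ∷ v)) (t ∷ w)) (ev-linear a b (λ v → h (d ∷ v)) w))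
  (rearr (δ s t) a b (ev (y ∘ (c ∷_)) (t ∷ w)) (ev (z ∘ (c ∷_)) (t ∷ w)) (ev (y ∘ (d ∷_)) w) (ev (z ∘ (d ∷_)) w))
  where
  rearr : ∀ k a b y z u v → (a * y + b * z) + k * (a * u + b * v) ≡ a * (y + k * u) + b * (z + k * v)
  rearr = solve-∀ ℚ-ring

-- A factor depending on the degree alone comes out because c and d are homogeneous. For constant
-- `κ` this is scalar multiplication; for `κ = ι ∘ suc` it is differentiation.
ev-deg : ∀ (κ : ℕ → ℚ) x w → ev (λ v → κ (deg v) * x v) w ≡ κ (length w) * ev x w
ev-deg κ x []          = refl
ev-deg κ x (s ∷ [])    = refl
ev-deg κ x (s ∷ t ∷ w) = trans
  (cong₂ (λ p q → p + δ s t * q) (ev-deg (κ ∘ suc) (x ∘ (c ∷_)) (t ∷ w)) (ev-deg (κ ∘ suc ∘ suc) (x ∘ (d ∷_)) w))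
  (rearr (δ s t) (κ (suc (suc (length w)))) (ev (x ∘ (c ∷_)) (t ∷ w)) (ev (x ∘ (d ∷_)) w))
  where
  rearr : ∀ k m p q → m * p + k * (m * q) ≡ m * (p + k * q)
  rearr = solve-∀ ℚ-ring

ev-zero : ∀ w → ev (λ _ → 0ℚ) w ≡ 0ℚ
ev-zero w = trans (ev-deg (λ _ → 0ℚ) (λ _ → 0ℚ) w) (ℚ.*-zeroˡ (ev (λ _ → 0ℚ) w))

-- The link between the enumeration `cdWords` in the definition of the cd-index and the recursive
-- `ev`; `u` stands for the factorial denominator, which the integer sum lacks.
ev-cdWords : ∀ w (F : List CD → ℤ) x u →
  (∀ v → deg v ≡ length w → fromℤ (F v) * u ≡ x v * ι (abCoeff v w)) →
  fromℤ (sumℤ (map F (cdWords (length w)))) * u ≡ ev x w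
ev-cdWords [] F x u h = trans (cong (λ i → fromℤ i * u) (ℤ.+-identityʳ (F [])))
  (trans (h [] refl) (trans (cong (x [] *_) (fromℤ-/1 (+ 1))) (ℚ.*-identityʳ (x []))))
ev-cdWords (s ∷ []) F x u h = trans (cong (λ i → fromℤ i * u) (ℤ.+-identityʳ (F (c ∷ []))))
  (trans (h (c ∷ []) refl) (trans (cong (x (c ∷ []) *_) (trans (cong ι (abCoeff-c [] s [])) (fromℤ-/1 (+ 1)))) (ℚ.*-identityʳ (x (c ∷ [])))))
ev-cdWords (s ∷ t ∷ w) F x u h = begin
  fromℤ (sumℤ (map F (map (c ∷_) (cdWords (suc (length w))) ++ map (d ∷_) (cdWords (length w))))) * u
    ≡⟨ cong (λ i → fromℤ i * u) (sumℤ-++ F (c ∷_) (d ∷_) (cdWords (suc (length w))) (cdWords (length w))) ⟩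
  fromℤ (s₁ ℤ.+ s₂) * u
    ≡⟨ cong (_* u) (fromℤ-+ s₁ s₂) ⟩
  (fromℤ s₁ + fromℤ s₂) * u
    ≡⟨ ℚ.*-distribʳ-+ u (fromℤ s₁) (fromℤ s₂) ⟩
  fromℤ s₁ * u + fromℤ s₂ * u
    ≡⟨ cong₂ _+_ (ev-cdWords (t ∷ w) (F ∘ (c ∷_)) (x ∘ (c ∷_)) u h₁)
                 (ev-cdWords w (F ∘ (d ∷_)) (λ v → δ s t * x (d ∷ v)) u h₂) ⟩
  ev (x ∘ (c ∷_)) (t ∷ w) + ev (λ v → δ s t * x (d ∷ v)) w
    ≡⟨ cong (λ y → ev (x ∘ (c ∷_)) (t ∷ w) + y) (ev-deg (λ _ → δ s t) (x ∘ (d ∷_)) w) ⟩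
  ev (x ∘ (c ∷_)) (t ∷ w) + δ s t * ev (x ∘ (d ∷_)) w ∎
  where
  open ≡-Reasoning
  s₁ = sumℤ (map (F ∘ (c ∷_)) (cdWords (suc (length w))))
  s₂ = sumℤ (map (F ∘ (d ∷_)) (cdWords (length w)))
  rearr : ∀ x k a → x * (k * a) ≡ (k * x) * a
  rearr = solve-∀ ℚ-ring
  h₁ : ∀ v → deg v ≡ suc (length w) → fromℤ (F (c ∷ v)) * u ≡ x (c ∷ v) * ι (abCoeff v (t ∷ w))
  h₁ v l = trans (h (c ∷ v) (cong suc l)) (cong (λ n → x (c ∷ v) * ι n) (abCoeff-c v s (t ∷ w)))
  h₂ : ∀ v → deg v ≡ length w → fromℤ (F (d ∷ v)) * u ≡ (δ s t * x (d ∷ v)) * ι (abCoeff v w)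
  h₂ v l = trans (h (d ∷ v) (cong (suc ∘ suc) l))
    (trans (cong (x (d ∷ v) *_) (abCoeff-d v s t w)) (rearr (x (d ∷ v)) (δ s t) (ι (abCoeff v w))))

-- Uniqueness of the cd-index. Two equal initial letters hide the words that begin with d, which
-- isolates the part beginning with c. That part does not see the first letter, so the difference
-- between ba w and aa w isolates the part beginning with d.
ev-injective : ∀ x v → (∀ w → length w ≡ deg v → ev x w ≡ 0ℚ) → x v ≡ 0ℚ
ev-injective x []      h = h [] refl
ev-injective x (c ∷ v) h = ev-injective (x ∘ (c ∷_)) v h′
  where
  drop₀ : ∀ a b → a + 0ℚ * b ≡ a
  drop₀ = solve-∀ ℚ-ring
  h′ : ∀ w → length w ≡ deg v → ev (x ∘ (c ∷_)) w ≡ 0ℚ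
  h′ []          l = h (true ∷ []) (cong suc l)
  h′ (false ∷ w) l = trans (sym (drop₀ (ev (x ∘ (c ∷_)) (false ∷ w)) (ev (x ∘ (d ∷_)) w))) (h (false ∷ false ∷ w) (cong suc l))
  h′ (true ∷ w)  l = trans (sym (drop₀ (ev (x ∘ (c ∷_)) (true ∷ w)) (ev (x ∘ (d ∷_)) w))) (h (true ∷ true ∷ w) (cong suc l))
ev-injective x (d ∷ v) h = ev-injective (x ∘ (d ∷_)) v h′
  where
  difference : ∀ a b → b ≡ (a + 1ℚ * b) - (a + 0ℚ * b)
  difference = solve-∀ ℚ-ring
  h′ : ∀ w → length w ≡ deg v → ev (x ∘ (d ∷_)) w ≡ 0ℚ
  h′ w l = trans (difference (ev (x ∘ (c ∷_)) (false ∷ w)) (ev (x ∘ (d ∷_)) w))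
    (cong₂ _-_ (h (true ∷ false ∷ w) (cong (suc ∘ suc) l)) (h (false ∷ false ∷ w) (cong (suc ∘ suc) l)))

-- The Riccati equation for cd-words

ifEmpty : List CD → ℚ
ifEmpty []      = 1ℚ
ifEmpty (_ ∷ _) = 0ℚ

-- The coefficient of a cd-word in 2 + cE.
cdEnds : (List CD → ℚ) → List CD → ℚ
cdEnds e []      = 1ℚ + 1ℚ
cdEnds e (c ∷ v) = e v
cdEnds e (d ∷ v) = 0ℚ

-- [v = v′c] y(v′) + Σ y(x) e(z) over the factorisations v = x d z.
cdSplits : (List CD → ℚ) → (List CD → ℚ) → List CD → ℚ
cdSplits e y []      = 0ℚ
cdSplits e y (c ∷ v) = ifEmpty v * y [] + cdSplits e (y ∘ (c ∷_)) v
cdSplits e y (d ∷ v) = e v * y [] + cdSplits e (y ∘ (d ∷_)) v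

ev-cdEnds : ∀ e → (∀ w → ev e w ≡ η 1 w) → ∀ w → ev (cdEnds e) w ≡ ends w
ev-cdEnds e h []          = refl
ev-cdEnds e h (s ∷ [])    = h []
ev-cdEnds e h (s ∷ t ∷ w) = trans
  (cong₂ (λ x y → x + δ s t * y) (h (t ∷ w)) (ev-zero w))
  (drop₀ (η 1 (t ∷ w)) (δ s t))
  where
  drop₀ : ∀ a b → a + b * 0ℚ ≡ a
  drop₀ = solve-∀ ℚ-ring

ev-ifEmpty : ∀ t w → ev ifEmpty (t ∷ w) ≡ 0ℚ
ev-ifEmpty t []      = refl
ev-ifEmpty t (s ∷ w) = trans (cong₂ (λ x y → x + δ t s * y) (ev-zero (s ∷ w)) (ev-zero w))
  (drop₀ (δ t s))
  where
  drop₀ : ∀ b → 0ℚ + b * 0ℚ ≡ 0ℚ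
  drop₀ = solve-∀ ℚ-ring

-- The left factor `y` must be general: stripping the first letter replaces it by `y ∘ (c ∷_)` or
-- `y ∘ (d ∷_)`, while the right factor stays `e`.
ev-cdSplits : ∀ e → (∀ w → ev e w ≡ η 1 w) → ∀ w y → ev (cdSplits e y) w ≡ splits kernel (ev y) w
ev-cdSplits e h []          y = refl
ev-cdSplits e h (s ∷ [])    y = refl
ev-cdSplits e h (s ∷ t ∷ w) y = begin
  ev (λ v → ifEmpty v * y [] + cdSplits e yc v) (t ∷ w) + δ s t * ev (λ v → e v * y [] + cdSplits e yd v) w
    ≡⟨ cong₂ (λ p q → p + δ s t * q)
         (ev-linear (y []) 1ℚ {y = ifEmpty} {z = cdSplits e yc} (λ v → comm (ifEmpty v) (y []) (cdSplits e yc v)) (t ∷ w))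
         (ev-linear (y []) 1ℚ {y = e} {z = cdSplits e yd} (λ v → comm (e v) (y []) (cdSplits e yd v)) w) ⟩
  (y [] * ev ifEmpty (t ∷ w) + 1ℚ * ev (cdSplits e yc) (t ∷ w)) + δ s t * (y [] * ev e w + 1ℚ * ev (cdSplits e yd) w)
    ≡⟨ cong₂ (λ p q → p + δ s t * q)
         (cong₂ (λ p q → y [] * p + 1ℚ * q) (ev-ifEmpty t w) (ev-cdSplits e h (t ∷ w) yc))
         (cong₂ (λ p q → y [] * p + 1ℚ * q) (h w) (ev-cdSplits e h w yd)) ⟩
  (y [] * 0ℚ + 1ℚ * (kernel t w * y (c ∷ []) + splits kernel (ev yc ∘ (t ∷_)) w)) + δ s t * (y [] * η 1 w + 1ℚ * splits kernel (ev yd) w)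
    ≡⟨ rearr (y []) (kernel t w * y (c ∷ [])) (splits kernel (ev yc ∘ (t ∷_)) w) (δ s t) (η 1 w) (splits kernel (ev yd) w) ⟩
  (δ s t * η 1 w) * y [] + (kernel t w * y (c ∷ []) + (1ℚ * splits kernel (ev yc ∘ (t ∷_)) w + δ s t * splits kernel (ev yd) w))
    ≡⟨ cong (λ x → (δ s t * η 1 w) * y [] + (kernel t w * y (c ∷ []) + x))
         (splits-linear kernel 1ℚ (δ s t) {Y = ev yc ∘ (t ∷_)} {Z = ev yd}
           (λ u → cong (_+ δ s t * ev yd u) (sym (ℚ.*-identityˡ (ev yc (t ∷ u))))) w) ⟨
  (δ s t * η 1 w) * y [] + (kernel t w * y (c ∷ []) + splits kernel (λ u → ev y (s ∷ t ∷ u)) w) ∎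
  where
  open ≡-Reasoning
  yc = y ∘ (c ∷_)
  yd = y ∘ (d ∷_)
  comm : ∀ a b z → a * b + z ≡ b * a + 1ℚ * z
  comm = solve-∀ ℚ-ring
  rearr : ∀ y k s m n t → (y * 0ℚ + 1ℚ * (k + s)) + m * (y * n + 1ℚ * t) ≡ (m * n) * y + (k + (1ℚ * s + m * t))
  rearr = solve-∀ ℚ-ring

Riccati : (List CD → ℚ) → Set
Riccati e = ∀ v → (1ℚ + 1ℚ) * (ι (suc (deg v)) * e v) ≡ cdEnds e v + cdSplits e e v

-- The difference of the two sides is itself a family of cd-coefficients. By `η-riccati` its
-- expansion vanishes on every ab-word, so `ev-injective` applies to it.
ev⇒Riccati : ∀ e → (∀ w → ev e w ≡ η 1 w) → Riccati e
ev⇒Riccati e h v = begin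
  (1ℚ + 1ℚ) * (ι (suc (deg v)) * e v)   ≡⟨ undo ((1ℚ + 1ℚ) * (ι (suc (deg v)) * e v)) (rhs v) ⟩
  defect v + rhs v                      ≡⟨ cong (_+ rhs v) (ev-injective defect v (λ w _ → ev-defect w)) ⟩
  0ℚ + rhs v                            ≡⟨ ℚ.+-identityˡ (rhs v) ⟩
  rhs v                                 ∎
  where
  open ≡-Reasoning
  lhs rhs defect : List CD → ℚ
  lhs v = ι (suc (deg v)) * e v
  rhs v = cdEnds e v + cdSplits e e v
  defect v = (1ℚ + 1ℚ) * lhs v - rhs v
  undo : ∀ a b → a ≡ (a - b) + b
  undo = solve-∀ ℚ-ring
  minus : ∀ k a b → k * a - b ≡ k * a + (- 1ℚ) * b
  minus = solve-∀ ℚ-ring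
  plus : ∀ a b → a + b ≡ 1ℚ * a + 1ℚ * b
  plus = solve-∀ ℚ-ring
  cancel : ∀ a b → (1ℚ * a + 1ℚ * b) + (- 1ℚ) * (1ℚ * a + 1ℚ * b) ≡ 0ℚ
  cancel = solve-∀ ℚ-ring
  splits-cong : ∀ {Y Z : List Bool → ℚ} → (∀ w → Y w ≡ Z w) → ∀ w → splits kernel Y w ≡ splits kernel Z w
  splits-cong h []      = refl
  splits-cong h (s ∷ w) = cong₂ (λ x y → kernel s w * x + y) (h []) (splits-cong (λ w → h (s ∷ w)) w)
  ev-defect : ∀ w → ev defect w ≡ 0ℚ
  ev-defect w = begin
    ev defect w
      ≡⟨ ev-linear (1ℚ + 1ℚ) (- 1ℚ) {y = lhs} {z = rhs} (λ v → minus (1ℚ + 1ℚ) (lhs v) (rhs v)) w ⟩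
    (1ℚ + 1ℚ) * ev lhs w + (- 1ℚ) * ev rhs w
      ≡⟨ cong₂ (λ x y → (1ℚ + 1ℚ) * x + (- 1ℚ) * y) (ev-deg (ι ∘ suc) e w)
           (ev-linear 1ℚ 1ℚ {y = cdEnds e} {z = cdSplits e e} (λ v → plus (cdEnds e v) (cdSplits e e v)) w) ⟩
    (1ℚ + 1ℚ) * (ι (suc (length w)) * ev e w) + (- 1ℚ) * (1ℚ * ev (cdEnds e) w + 1ℚ * ev (cdSplits e e) w)
      ≡⟨ cong₂ (λ x y → (1ℚ + 1ℚ) * (ι (suc (length w)) * x) + (- 1ℚ) * y) (h w)
           (cong₂ (λ x y → 1ℚ * x + 1ℚ * y) (ev-cdEnds e h w)
             (trans (ev-cdSplits e h w e) (splits-cong h w))) ⟩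
    (1ℚ + 1ℚ) * (ι (suc (length w)) * η 1 w) + (- 1ℚ) * (1ℚ * ends w + 1ℚ * splits kernel (η 1) w)
      ≡⟨ cong (_+ (- 1ℚ) * (1ℚ * ends w + 1ℚ * splits kernel (η 1) w))
           (trans (η-riccati w) (plus (ends w) (splits kernel (η 1) w))) ⟩
    (1ℚ * ends w + 1ℚ * splits kernel (η 1) w) + (- 1ℚ) * (1ℚ * ends w + 1ℚ * splits kernel (η 1) w)
      ≡⟨ cancel (ends w) (splits kernel (η 1) w) ⟩
    0ℚ ∎

-- Normalised coefficients of the Boolean cd-index

normalise : (List CD → ℤ) → List CD → ℚ
normalise β v = fromℤ (β v) * invFact (suc (deg v))

normalise-riccati : ∀ β → IsBooleanCDIndex β → Riccati (normalise β)
normalise-riccati β cdIndex = ev⇒Riccati (normalise β) (λ w → trans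
  (sym (ev-cdWords w (λ v → β v ℤ.* (+ abCoeff v w)) (normalise β) (invFact (suc (length w))) (term w)))
  (trans (cong (λ i → fromℤ i * invFact (suc (length w))) (cdIndex w)) (hB-η w)))
  where
  rearr : ∀ a b z → (a * b) * z ≡ (a * z) * b
  rearr = solve-∀ ℚ-ring
  term : ∀ w v → deg v ≡ length w →
    fromℤ (β v ℤ.* (+ abCoeff v w)) * invFact (suc (length w)) ≡ normalise β v * ι (abCoeff v w)
  term w v l = trans (cong₂ _*_ (fromℤ-* (β v) (+ abCoeff v w)) (cong (invFact ∘ suc) (sym l)))
    (rearr (fromℤ (β v)) (ι (abCoeff v w)) (invFact (suc (deg v))))

-- Inequalities between the coefficients of the tangent

0≤* : ∀ {p q} → 0ℚ ≤ p → 0ℚ ≤ q → 0ℚ ≤ p * q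
0≤* {p} {q} 0≤p 0≤q = ℚ.nonNegative⁻¹ (p * q)
  {{ℚ.nonNeg*nonNeg⇒nonNeg p {{nonNegative 0≤p}} q {{nonNegative 0≤q}}}}

0≤+ : ∀ {p q} → 0ℚ ≤ p → 0ℚ ≤ q → 0ℚ ≤ p + q
0≤+ {p} {q} 0≤p 0≤q = subst (_≤ p + q) (ℚ.+-identityʳ 0ℚ) (ℚ.+-mono-≤ 0≤p 0≤q)

*-monoˡ : ∀ {r p q} → 0ℚ ≤ r → p ≤ q → r * p ≤ r * q
*-monoˡ {r} 0≤r = ℚ.*-monoˡ-≤-nonNeg r {{nonNegative 0≤r}}

*-monoʳ : ∀ {r p q} → 0ℚ ≤ r → p ≤ q → p * r ≤ q * r
*-monoʳ {r} 0≤r = ℚ.*-monoʳ-≤-nonNeg r {{nonNegative 0≤r}}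

*-mono : ∀ {p p′ q q′} → 0ℚ ≤ p′ → 0ℚ ≤ q → p ≤ p′ → q ≤ q′ → p * q ≤ p′ * q′
*-mono 0≤p′ 0≤q p≤p′ q≤q′ = ℚ.≤-trans (*-monoʳ 0≤q p≤p′) (*-monoˡ 0≤p′ q≤q′)

p≤p+q : ∀ {p q} → 0ℚ ≤ q → p ≤ p + q
p≤p+q {p} {q} 0≤q = subst (_≤ p + q) (ℚ.+-identityʳ p) (ℚ.+-monoʳ-≤ p 0≤q)

p≤q⇒0≤q-p : ∀ {p q} → p ≤ q → 0ℚ ≤ q - p
p≤q⇒0≤q-p {p} {q} p≤q = subst (_≤ q - p) (ℚ.+-inverseʳ p) (ℚ.+-monoˡ-≤ (- p) p≤q)

≤-surplus : ∀ {p q r} → 0ℚ ≤ r → p + r ≡ q → p ≤ q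
≤-surplus 0≤r eq = ℚ.≤-trans (p≤p+q 0≤r) (ℚ.≤-reflexive eq)

2ℚ : ℚ
2ℚ = 1ℚ + 1ℚ

odd : ℕ → ℚ
odd n = 1ℚ + (ι n + ι n)

ι-odd : ∀ n → ι (suc (n ℕ.+ n)) ≡ odd n
ι-odd n = trans (ι-suc (n ℕ.+ n)) (cong (λ x → 1ℚ + x) (ι-+ n n))

2ι-cancel-≤ : ∀ n {p q} → 2ℚ * (ι (suc n) * p) ≤ 2ℚ * (ι (suc n) * q) → p ≤ q
2ι-cancel-≤ n h = ℚ.*-cancelˡ-≤-pos (ι (suc n)) {{ι-pos n}} (ℚ.*-cancelˡ-≤-pos 2ℚ h)

2ι-cancel : ∀ n {p q} → 2ℚ * (ι (suc n) * p) ≡ 2ℚ * (ι (suc n) * q) → p ≡ q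
2ι-cancel n h = ℚ.≤-antisym (2ι-cancel-≤ n (ℚ.≤-reflexive h)) (2ι-cancel-≤ n (ℚ.≤-reflexive (sym h)))

-- The sum runs over i + j = n - 1, so it has exactly n terms. With this shift `conv-split` cuts a
-- sum of m + n terms into its first m and its last n.
conv : (ℕ → ℚ) → (ℕ → ℚ) → ℕ → ℚ
conv f g zero    = 0ℚ
conv f g (suc n) = f 0 * g n + conv (f ∘ suc) g n

conv-split : ∀ f g m n → conv f g (m ℕ.+ n) ≡ conv f (λ j → g (n ℕ.+ j)) m + conv (λ i → f (m ℕ.+ i)) g n
conv-split f g zero    n = sym (ℚ.+-identityˡ (conv f g n))
conv-split f g (suc m) n = trans
  (cong₂ (λ k x → f 0 * g k + x) (ℕ.+-comm m n) (conv-split (f ∘ suc) g m n))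
  (sym (ℚ.+-assoc (f 0 * g (n ℕ.+ m)) _ _))

conv-monoˡ : ∀ {f f′ g} n → (∀ j → 0ℚ ≤ g j) → (∀ i → i ℕ.< n → f i ≤ f′ i) → conv f g n ≤ conv f′ g n
conv-monoˡ zero    0≤g f≤f′ = ℚ.≤-refl
conv-monoˡ (suc n) 0≤g f≤f′ = ℚ.+-mono-≤ (*-monoʳ (0≤g n) (f≤f′ 0 (s≤s z≤n)))
  (conv-monoˡ n 0≤g (λ i i<n → f≤f′ (suc i) (s≤s i<n)))

conv-monoʳ : ∀ {f g g′} n → (∀ i → 0ℚ ≤ f i) → (∀ j → j ℕ.< n → g j ≤ g′ j) → conv f g n ≤ conv f g′ n
conv-monoʳ zero    0≤f g≤g′ = ℚ.≤-refl
conv-monoʳ (suc n) 0≤f g≤g′ = ℚ.+-mono-≤ (*-monoˡ (0≤f 0) (g≤g′ n ℕ.≤-refl))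
  (conv-monoʳ n (0≤f ∘ suc) (λ j j<n → g≤g′ j (ℕ.m≤n⇒m≤1+n j<n)))

conv-*ˡ : ∀ k f g n → conv (λ i → k * f i) g n ≡ k * conv f g n
conv-*ˡ k f g zero    = sym (ℚ.*-zeroʳ k)
conv-*ˡ k f g (suc n) = trans (cong (λ x → k * f 0 * g n + x) (conv-*ˡ k (f ∘ suc) g n))
  (rearr k (f 0) (g n) (conv (f ∘ suc) g n))
  where
  rearr : ∀ k f g x → k * f * g + k * x ≡ k * (f * g + x)
  rearr = solve-∀ ℚ-ring

conv-*ʳ : ∀ k f g n → conv f (λ j → k * g j) n ≡ k * conv f g n
conv-*ʳ k f g zero    = sym (ℚ.*-zeroʳ k)
conv-*ʳ k f g (suc n) = trans (cong (λ x → f 0 * (k * g n) + x) (conv-*ʳ k (f ∘ suc) g n))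
  (rearr k (f 0) (g n) (conv (f ∘ suc) g n))
  where
  rearr : ∀ k f g x → f * (k * g) + k * x ≡ k * (f * g + x)
  rearr = solve-∀ ℚ-ring

-- `s₀` and `s-rec` are the coefficients of 2y′ = 2 + y² for y = Σ sₙ x²ⁿ⁺¹, the equation of √2
-- tan(x/√2).
module Tangent (s : ℕ → ℚ) (0≤s : ∀ n → 0ℚ ≤ s n) (s₀ : s 0 ≡ 1ℚ)
  (s-rec : ∀ n → 2ℚ * (odd (suc n) * s (suc n)) ≡ conv s s (suc n)) where

  odd-+ : ∀ m n → odd m + odd n ≡ odd (m ℕ.+ n) + 1ℚ
  odd-+ m n = trans (rearr (ι m) (ι n)) (cong (λ x → 1ℚ + (x + x) + 1ℚ) (sym (ι-+ m n)))
    where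
    rearr : ∀ x y → (1ℚ + (x + x)) + (1ℚ + (y + y)) ≡ 1ℚ + ((x + y) + (x + y)) + 1ℚ
    rearr = solve-∀ ℚ-ring

  odd-suc : ∀ n → odd (suc n) ≡ 2ℚ + odd n
  odd-suc n = trans (cong (λ x → 1ℚ + (x + x)) (ι-suc n)) (rearr (ι n))
    where
    rearr : ∀ x → 1ℚ + ((1ℚ + x) + (1ℚ + x)) ≡ 2ℚ + (1ℚ + (x + x))
    rearr = solve-∀ ℚ-ring

  odd-cancel-≤ : ∀ n {p q} → 2ℚ * (odd n * p) ≤ 2ℚ * (odd n * q) → p ≤ q
  odd-cancel-≤ n {p} {q} h = 2ι-cancel-≤ (n ℕ.+ n)
    (subst (λ x → 2ℚ * (x * p) ≤ 2ℚ * (x * q)) (sym (ι-odd n)) h)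

  -- Since odd A + odd B = odd (A + B) + 1, the product s A · s B satisfies a recursion with A + B
  -- terms, each of which lies by induction below a term in the recursion of s (A + B). The excess 1
  -- works in the right direction.
  s-supermul : ∀ a b → s a * s b ≤ s (a ℕ.+ b)
  s-supermul a b = go (suc (a ℕ.+ b)) a b ℕ.≤-refl
    where
    open ℚ.≤-Reasoning
    go : ∀ k a b → a ℕ.+ b ℕ.< k → s a * s b ≤ s (a ℕ.+ b)
    go k       zero    b       _         = ℚ.≤-reflexive (trans (cong (_* s b) s₀) (ℚ.*-identityˡ (s b)))
    go k       (suc a) zero    _         = ℚ.≤-reflexive (trans (cong (s (suc a) *_) s₀)
      (trans (ℚ.*-identityʳ (s (suc a))) (cong s (sym (ℕ.+-identityʳ (suc a))))))
    go (suc k) (suc a) (suc b) (s≤s a+b<k) = odd-cancel-≤ (A ℕ.+ B) (begin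
      2ℚ * (odd (A ℕ.+ B) * (s A * s B))
        ≤⟨ ≤-surplus (0≤* {2ℚ} (ℚ.nonNegative⁻¹ 2ℚ) (0≤* (0≤s A) (0≤s B))) (rearr₁ (odd (A ℕ.+ B)) (s A * s B)) ⟩
      2ℚ * ((odd (A ℕ.+ B) + 1ℚ) * (s A * s B))
        ≡⟨ cong (λ x → 2ℚ * (x * (s A * s B))) (odd-+ A B) ⟨
      2ℚ * ((odd A + odd B) * (s A * s B))
        ≡⟨ rearr₂ (odd A) (odd B) (s A) (s B) ⟩
      s B * (2ℚ * (odd A * s A)) + s A * (2ℚ * (odd B * s B))
        ≡⟨ cong₂ (λ x y → s B * x + s A * y) (s-rec a) (s-rec b) ⟩
      s B * conv s s A + s A * conv s s B
        ≡⟨ cong₂ _+_ (conv-*ʳ (s B) s s A) (conv-*ˡ (s A) s s B) ⟨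
      conv s (λ j → s B * s j) A + conv (λ i → s A * s i) s B
        ≤⟨ ℚ.+-mono-≤ (conv-monoʳ A 0≤s (λ j j<A → go k B j (ih₂ j<A))) (conv-monoˡ B 0≤s (λ i i<B → go k A i (ih₁ i<B))) ⟩
      conv s (λ j → s (B ℕ.+ j)) A + conv (λ i → s (A ℕ.+ i)) s B
        ≡⟨ conv-split s s A B ⟨
      conv s s (A ℕ.+ B)
        ≡⟨ s-rec (a ℕ.+ B) ⟨
      2ℚ * (odd (A ℕ.+ B) * s (A ℕ.+ B)) ∎)
      where
      A = suc a
      B = suc b
      ih₁ : ∀ {i} → i ℕ.< B → A ℕ.+ i ℕ.< k
      ih₁ i<B = ℕ.<-≤-trans (ℕ.+-monoʳ-< A i<B) a+b<k
      ih₂ : ∀ {j} → j ℕ.< A → B ℕ.+ j ℕ.< k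
      ih₂ {j} j<A = ℕ.<-≤-trans (subst (ℕ._< A ℕ.+ B) (ℕ.+-comm j B) (ℕ.+-monoˡ-< B j<A)) a+b<k
      rearr₁ : ∀ o x → 2ℚ * (o * x) + 2ℚ * x ≡ 2ℚ * ((o + 1ℚ) * x)
      rearr₁ = solve-∀ ℚ-ring
      rearr₂ : ∀ o q x y → 2ℚ * ((o + q) * (x * y)) ≡ y * (2ℚ * (o * x)) + x * (2ℚ * (q * y))
      rearr₂ = solve-∀ ℚ-ring

  odd-literal : ∀ n → odd n ≡ 1ℚ + ((+ n / 1) + (+ n / 1))
  odd-literal n = cong (λ x → 1ℚ + (x + x)) (fromℤ-/1 (+ n))

  s₁ : (+ 6 / 1) * s 1 ≡ 1ℚ
  s₁ = begin
    (+ 6 / 1) * s 1                     ≡⟨ rearr₁ (s 1) ⟩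
    2ℚ * ((1ℚ + (1ℚ + 1ℚ)) * s 1)       ≡⟨ cong (λ x → 2ℚ * (x * s 1)) (odd-literal 1) ⟨
    2ℚ * (odd 1 * s 1)                  ≡⟨ s-rec 0 ⟩
    s 0 * s 0 + 0ℚ                      ≡⟨ cong (λ x → x * x + 0ℚ) s₀ ⟩
    1ℚ                                  ∎
    where
    open ≡-Reasoning
    rearr₁ : ∀ x → (+ 6 / 1) * x ≡ 2ℚ * ((1ℚ + (1ℚ + 1ℚ)) * x)
    rearr₁ = solve-∀ ℚ-ring

  s₂ : (+ 30 / 1) * s 2 ≡ 1ℚ
  s₂ = begin
    (+ 30 / 1) * s 2                                   ≡⟨ rearr₁ (s 2) ⟩
    (+ 3 / 1) * (2ℚ * ((1ℚ + (2ℚ + 2ℚ)) * s 2))        ≡⟨ cong (λ x → (+ 3 / 1) * (2ℚ * (x * s 2))) (odd-literal 2) ⟨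
    (+ 3 / 1) * (2ℚ * (odd 2 * s 2))                   ≡⟨ cong ((+ 3 / 1) *_) (s-rec 1) ⟩
    (+ 3 / 1) * (s 0 * s 1 + (s 1 * s 0 + 0ℚ))         ≡⟨ cong (λ x → (+ 3 / 1) * (x * s 1 + (s 1 * x + 0ℚ))) s₀ ⟩
    (+ 3 / 1) * (1ℚ * s 1 + (s 1 * 1ℚ + 0ℚ))           ≡⟨ rearr₂ (s 1) ⟩
    (+ 6 / 1) * s 1                                    ≡⟨ s₁ ⟩
    1ℚ                                                 ∎
    where
    open ≡-Reasoning
    rearr₁ : ∀ x → (+ 30 / 1) * x ≡ (+ 3 / 1) * (2ℚ * ((1ℚ + (2ℚ + 2ℚ)) * x))
    rearr₁ = solve-∀ ℚ-ring
    rearr₂ : ∀ x → (+ 3 / 1) * (1ℚ * x + (x * 1ℚ + 0ℚ)) ≡ (+ 6 / 1) * x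
    rearr₂ = solve-∀ ℚ-ring

  s-split₁ : ∀ n → conv s s (suc n) ≡ s n + conv (s ∘ suc) s n
  s-split₁ n = cong (_+ conv (s ∘ suc) s n) (trans (cong (_* s n) s₀) (ℚ.*-identityˡ (s n)))

  s-split₁ʳ : ∀ n → conv s s (suc n) ≡ conv s (s ∘ suc) n + s n
  s-split₁ʳ n = begin
    conv s s (suc n)                              ≡⟨ cong (conv s s) (ℕ.+-comm n 1) ⟨
    conv s s (n ℕ.+ 1)                            ≡⟨ conv-split s s n 1 ⟩
    conv s (s ∘ suc) n + (s (n ℕ.+ 0) * s 0 + 0ℚ) ≡⟨ cong₂ (λ k x → conv s (s ∘ suc) n + (s k * x + 0ℚ)) (ℕ.+-identityʳ n) s₀ ⟩
    conv s (s ∘ suc) n + (s n * 1ℚ + 0ℚ)          ≡⟨ cong (λ x → conv s (s ∘ suc) n + x) (trans (ℚ.+-identityʳ (s n * 1ℚ)) (ℚ.*-identityʳ (s n))) ⟩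
    conv s (s ∘ suc) n + s n                      ∎
    where open ≡-Reasoning

  -- Supermultiplicativity with first index 1, where s 1 = 1/6.
  s-step : ∀ n → 0ℚ ≤ (+ 6 / 1) * s (suc n) - s n
  s-step n = p≤q⇒0≤q-p (begin
    s n                             ≡⟨ ℚ.*-identityˡ (s n) ⟨
    1ℚ * s n                        ≡⟨ cong (_* s n) s₁ ⟨
    (+ 6 / 1) * s 1 * s n           ≡⟨ ℚ.*-assoc (+ 6 / 1) (s 1) (s n) ⟩
    (+ 6 / 1) * (s 1 * s n)         ≤⟨ *-monoˡ {+ 6 / 1} (ℚ.nonNegative⁻¹ (+ 6 / 1)) (s-supermul 1 n) ⟩
    (+ 6 / 1) * s (suc n)           ∎)
    where open ℚ.≤-Reasoning

  -- The induction step leaves the surplus (6 s(a+1) - s(a)) (6 s(b+1) - s(b)).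
  s-supermul₁ : ∀ a b → (+ 6 / 1) * (s (suc a) * s (suc b)) ≤ s (suc (a ℕ.+ b))
  s-supermul₁ a b = go (suc (a ℕ.+ b)) a b ℕ.≤-refl
    where
    open ℚ.≤-Reasoning
    6ℚ = + 6 / 1
    go : ∀ k a b → a ℕ.+ b ℕ.< k → 6ℚ * (s (suc a) * s (suc b)) ≤ s (suc (a ℕ.+ b))
    go (suc k) a b (s≤s a+b≤k) = odd-cancel-≤ N (begin
      2ℚ * (odd N * (6ℚ * (x * y)))
        ≤⟨ ≤-surplus (0≤* (s-step a) (s-step b)) (rearr (odd N) x y (s a) (s b)) ⟩
      6ℚ * y * (2ℚ * ((odd N + 1ℚ) * x) - s a)
        + (s a * s b + 6ℚ * x * (2ℚ * (2ℚ * y) - s b))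
        ≡⟨ distribute ⟩
      6ℚ * y * (2ℚ * (odd (suc a) * x) - s a) + (s a * s b + 6ℚ * x * (2ℚ * (odd (suc b) * y) - s b))
        -- The induction hypothesis needs two positive indices, so the term containing s 0 is
        -- removed from each convolution. The product s a · s b matches the one term of the target
        -- sum that neither induction covers.
        ≡⟨ cong₂ (λ p q → 6ℚ * y * (p - s a) + (s a * s b + 6ℚ * x * (q - s b)))
             (trans (s-rec a) (s-split₁ʳ a)) (trans (s-rec b) (s-split₁ b)) ⟩
      6ℚ * y * (conv s (s ∘ suc) a + s a - s a) + (s a * s b + 6ℚ * x * (s b + conv (s ∘ suc) s b - s b))
        ≡⟨ cancel (6ℚ * y) (6ℚ * x) (conv s (s ∘ suc) a) (conv (s ∘ suc) s b) (s a) (s b) ⟩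
      6ℚ * y * conv s (s ∘ suc) a + (s a * s b + 6ℚ * x * conv (s ∘ suc) s b)
        ≡⟨ cong₂ (λ p q → p + (s a * s b + q)) (conv-*ʳ (6ℚ * y) s (s ∘ suc) a) (conv-*ˡ (6ℚ * x) (s ∘ suc) s b) ⟨
      conv s (λ j → 6ℚ * y * s (suc j)) a + (s a * s b + conv (λ i → 6ℚ * x * s (suc i)) s b)
        ≤⟨ ℚ.+-mono-≤ (conv-monoʳ a 0≤s ih₂) (ℚ.+-monoʳ-≤ (s a * s b) (conv-monoˡ b 0≤s ih₁)) ⟩
      conv s (λ j → s (suc b ℕ.+ j)) a + (s a * s b + conv (λ i → s (a ℕ.+ suc i)) s b)
        ≡⟨ cong (λ n → conv s (λ j → s (suc b ℕ.+ j)) a + (s n * s b + conv (λ i → s (a ℕ.+ suc i)) s b)) (ℕ.+-identityʳ a) ⟨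
      conv s (λ j → s (suc b ℕ.+ j)) a + conv (λ i → s (a ℕ.+ i)) s (suc b)
        ≡⟨ conv-split s s a (suc b) ⟨
      conv s s (a ℕ.+ suc b)
        ≡⟨ cong (conv s s) (ℕ.+-suc a b) ⟩
      conv s s N
        ≡⟨ s-rec (a ℕ.+ b) ⟨
      2ℚ * (odd N * s N) ∎)
      where
      N = suc (a ℕ.+ b)
      x = s (suc a)
      y = s (suc b)
      rearr : ∀ o x y u v →
        2ℚ * (o * (6ℚ * (x * y))) + (6ℚ * x - u) * (6ℚ * y - v)
          ≡ 6ℚ * y * (2ℚ * ((o + 1ℚ) * x) - u) + (u * v + 6ℚ * x * (2ℚ * (2ℚ * y) - v))
      rearr = solve-∀ ℚ-ring
      spread : ∀ o p q x y u v → p + q ≡ o + 1ℚ + 2ℚ →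
        6ℚ * y * (2ℚ * ((o + 1ℚ) * x) - u) + (u * v + 6ℚ * x * (2ℚ * (2ℚ * y) - v))
          ≡ 6ℚ * y * (2ℚ * (p * x) - u) + (u * v + 6ℚ * x * (2ℚ * (q * y) - v))
      spread o p q x y u v h = trans (lhs o x y u v) (trans (cong (λ z → 6ℚ * y * x * 2ℚ * z + (u * v - 6ℚ * y * u - 6ℚ * x * v)) (sym h)) (rhs p q x y u v))
        where
        lhs : ∀ o x y u v → 6ℚ * y * (2ℚ * ((o + 1ℚ) * x) - u) + (u * v + 6ℚ * x * (2ℚ * (2ℚ * y) - v))
          ≡ 6ℚ * y * x * 2ℚ * (o + 1ℚ + 2ℚ) + (u * v - 6ℚ * y * u - 6ℚ * x * v)
        lhs = solve-∀ ℚ-ring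
        rhs : ∀ p q x y u v → 6ℚ * y * x * 2ℚ * (p + q) + (u * v - 6ℚ * y * u - 6ℚ * x * v)
          ≡ 6ℚ * y * (2ℚ * (p * x) - u) + (u * v + 6ℚ * x * (2ℚ * (q * y) - v))
        rhs = solve-∀ ℚ-ring
      odds : odd (suc a) + odd (suc b) ≡ odd N + 1ℚ + 2ℚ
      odds = trans (odd-+ (suc a) (suc b)) (trans (cong (_+ 1ℚ) (trans (cong (odd ∘ suc) (ℕ.+-suc a b)) (odd-suc N))) (assoc (odd N)))
        where
        assoc : ∀ o → 2ℚ + o + 1ℚ ≡ o + 1ℚ + 2ℚ
        assoc = solve-∀ ℚ-ring
      distribute = spread (odd N) (odd (suc a)) (odd (suc b)) x y (s a) (s b) odds
      cancel : ∀ k l p q u v → k * (p + u - u) + (u * v + l * (v + q - v)) ≡ k * p + (u * v + l * q)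
      cancel = solve-∀ ℚ-ring
      ih₁ : ∀ i → i ℕ.< b → 6ℚ * x * s (suc i) ≤ s (a ℕ.+ suc i)
      ih₁ i i<b = subst₂ _≤_ (sym (ℚ.*-assoc 6ℚ x (s (suc i)))) (cong s (sym (ℕ.+-suc a i)))
        (go k a i (ℕ.<-≤-trans (ℕ.+-monoʳ-< a i<b) a+b≤k))
      ih₂ : ∀ j → j ℕ.< a → 6ℚ * y * s (suc j) ≤ s (suc b ℕ.+ j)
      ih₂ j j<a = subst (_≤ s (suc b ℕ.+ j)) (sym (ℚ.*-assoc 6ℚ y (s (suc j))))
        (go k b j (ℕ.<-≤-trans (subst (ℕ._< a ℕ.+ b) (ℕ.+-comm j b) (ℕ.+-monoˡ-< b j<a)) a+b≤k))

  -- The constant is 5 = 1 / (6 s 2). The ratio s n / s (n+1) tends to π²/2 = 4.93.., so little is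
  -- lost.
  s-ratio-lower : ∀ n → s (suc n) ≤ (+ 5 / 1) * s (2 ℕ.+ n)
  s-ratio-lower n = begin
    s (suc n)                                          ≡⟨ ℚ.*-identityˡ (s (suc n)) ⟨
    1ℚ * s (suc n)                                     ≡⟨ cong (_* s (suc n)) s₂ ⟨
    (+ 30 / 1) * s 2 * s (suc n)                       ≡⟨ rearr (s 2) (s (suc n)) ⟩
    (+ 5 / 1) * ((+ 6 / 1) * (s 2 * s (suc n)))        ≤⟨ *-monoˡ {+ 5 / 1} (ℚ.nonNegative⁻¹ (+ 5 / 1)) (s-supermul₁ 1 n) ⟩
    (+ 5 / 1) * s (2 ℕ.+ n)                            ∎
    where
    open ℚ.≤-Reasoning
    rearr : ∀ x y → (+ 30 / 1) * x * y ≡ (+ 5 / 1) * ((+ 6 / 1) * (x * y))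
    rearr = solve-∀ ℚ-ring

  -- In fact 24 s 3 = (34/35) s 1. This is a base case of `s-ratio-upper`, whose induction step
  -- begins at n = 2.
  s₃-bound : (+ 24 / 1) * s 3 ≤ s 1
  s₃-bound = ℚ.*-cancelˡ-≤-pos (+ 210 / 1) (begin
    (+ 210 / 1) * ((+ 24 / 1) * s 3)
      ≡⟨ rearr₁ (s 3) ⟩
    (+ 360 / 1) * (2ℚ * ((1ℚ + ((+ 3 / 1) + (+ 3 / 1))) * s 3))
      ≡⟨ cong (λ x → (+ 360 / 1) * (2ℚ * (x * s 3))) (odd-literal 3) ⟨
    (+ 360 / 1) * (2ℚ * (odd 3 * s 3))
      ≡⟨ cong ((+ 360 / 1) *_) (s-rec 2) ⟩
    (+ 360 / 1) * (s 0 * s 2 + (s 1 * s 1 + (s 2 * s 0 + 0ℚ)))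
      ≡⟨ cong (λ x → (+ 360 / 1) * (x * s 2 + (s 1 * s 1 + (s 2 * x + 0ℚ)))) s₀ ⟩
    (+ 360 / 1) * (1ℚ * s 2 + (s 1 * s 1 + (s 2 * 1ℚ + 0ℚ)))
      ≡⟨ rearr₂ (s 1) (s 2) ⟩
    (+ 24 / 1) * ((+ 30 / 1) * s 2) + (+ 10 / 1) * ((+ 6 / 1) * s 1 * ((+ 6 / 1) * s 1))
      ≡⟨ cong₂ (λ x y → (+ 24 / 1) * x + (+ 10 / 1) * (y * y)) s₂ s₁ ⟩
    (+ 34 / 1)
      ≤⟨ ℚ.≤ᵇ⇒≤ _ ⟩
    (+ 35 / 1) * 1ℚ
      ≡⟨ cong ((+ 35 / 1) *_) s₁ ⟨
    (+ 35 / 1) * ((+ 6 / 1) * s 1)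
      ≡⟨ rearr₃ (s 1) ⟩
    (+ 210 / 1) * s 1 ∎)
    where
    open ℚ.≤-Reasoning
    rearr₁ : ∀ x → (+ 210 / 1) * ((+ 24 / 1) * x) ≡ (+ 360 / 1) * (2ℚ * ((1ℚ + ((+ 3 / 1) + (+ 3 / 1))) * x))
    rearr₁ = solve-∀ ℚ-ring
    rearr₂ : ∀ x y → (+ 360 / 1) * (1ℚ * y + (x * x + (y * 1ℚ + 0ℚ)))
      ≡ (+ 24 / 1) * ((+ 30 / 1) * y) + (+ 10 / 1) * ((+ 6 / 1) * x * ((+ 6 / 1) * x))
    rearr₂ = solve-∀ ℚ-ring
    rearr₃ : ∀ x → (+ 35 / 1) * ((+ 6 / 1) * x) ≡ (+ 210 / 1) * x
    rearr₃ = solve-∀ ℚ-ring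

  -- The ratio s(n+2) / s(n) increases to (2/π²)² = 0.98../24, so the constant 24 is nearly optimal.
  s-ratio-upper : ∀ n → (+ 24 / 1) * s (2 ℕ.+ n) ≤ s n
  s-ratio-upper n = go (suc n) n ℕ.≤-refl
    where
    open ℚ.≤-Reasoning
    go : ∀ k n → n ℕ.< k → (+ 24 / 1) * s (2 ℕ.+ n) ≤ s n
    go k       zero          _ = ℚ.*-cancelˡ-≤-pos (+ 5 / 1) (begin
      (+ 5 / 1) * ((+ 24 / 1) * s 2)   ≡⟨ rearr (s 2) ⟩
      (+ 4 / 1) * ((+ 30 / 1) * s 2)   ≡⟨ cong ((+ 4 / 1) *_) s₂ ⟩
      (+ 4 / 1) * 1ℚ                   ≤⟨ ℚ.≤ᵇ⇒≤ _ ⟩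
      (+ 5 / 1) * 1ℚ                   ≡⟨ cong ((+ 5 / 1) *_) s₀ ⟨
      (+ 5 / 1) * s 0                  ∎)
      where
      rearr : ∀ x → (+ 5 / 1) * ((+ 24 / 1) * x) ≡ (+ 4 / 1) * ((+ 30 / 1) * x)
      rearr = solve-∀ ℚ-ring
    go k       (suc zero)    _ = s₃-bound
    go (suc k) (suc (suc m)) (s≤s n<k) = odd-cancel-≤ (4 ℕ.+ m) (begin
      2ℚ * (odd (4 ℕ.+ m) * (24ℚ * s (4 ℕ.+ m)))
        ≡⟨ pull (odd (4 ℕ.+ m)) (s (4 ℕ.+ m)) ⟩
      24ℚ * (2ℚ * (odd (4 ℕ.+ m) * s (4 ℕ.+ m)))
        ≡⟨ cong (24ℚ *_) (s-rec (3 ℕ.+ m)) ⟩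
      24ℚ * (s 0 * s (3 ℕ.+ m) + (s 1 * s (2 ℕ.+ m) + (s 2 * s (suc m) + conv (s ∘ suc ∘ suc ∘ suc) s (suc m))))
        -- Only the terms with first index 0 and at least 3 use induction. The indices 1 and 2 use
        -- the exact values 24 s 1 = 4 and 24 s 2 = 4/5; bounding 24 s 2 by s 0 = 1 instead would
        -- exceed the available total.
        ≡⟨ expand′ (s 0) (s 1) (s 2) (s (3 ℕ.+ m)) (s (2 ℕ.+ m)) (s (suc m)) (conv (s ∘ suc ∘ suc ∘ suc) s (suc m)) ⟩
      s 0 * (24ℚ * s (3 ℕ.+ m)) + ((+ 4 / 1) * ((+ 6 / 1) * s 1 * s (2 ℕ.+ m)) + ((+ 4 / 5) * ((+ 30 / 1) * s 2 * s (suc m)) + 24ℚ * conv (s ∘ suc ∘ suc ∘ suc) s (suc m)))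
        ≡⟨ cong₂ (λ p q → p * (24ℚ * s (3 ℕ.+ m)) + q) s₀
             (cong₂ (λ p q → (+ 4 / 1) * (p * s (2 ℕ.+ m)) + ((+ 4 / 5) * (q * s (suc m)) + 24ℚ * conv (s ∘ suc ∘ suc ∘ suc) s (suc m))) s₁ s₂) ⟩
      1ℚ * (24ℚ * s (3 ℕ.+ m)) + ((+ 4 / 1) * (1ℚ * s (2 ℕ.+ m)) + ((+ 4 / 5) * (1ℚ * s (suc m)) + 24ℚ * conv (s ∘ suc ∘ suc ∘ suc) s (suc m)))
        ≤⟨ ℚ.+-mono-≤ (*-monoˡ {1ℚ} (ℚ.nonNegative⁻¹ 1ℚ) (go k (suc m) n<k))
             (ℚ.+-monoʳ-≤ ((+ 4 / 1) * (1ℚ * s (2 ℕ.+ m))) (ℚ.+-monoʳ-≤ ((+ 4 / 5) * (1ℚ * s (suc m))) tail)) ⟩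
      1ℚ * s (suc m) + ((+ 4 / 1) * (1ℚ * s (2 ℕ.+ m)) + ((+ 4 / 5) * (1ℚ * s (suc m)) + conv (s ∘ suc) s (suc m)))
        ≡⟨ cong (λ z → 1ℚ * s (suc m) + ((+ 4 / 1) * (1ℚ * s (2 ℕ.+ m)) + ((+ 4 / 5) * (1ℚ * s (suc m)) + z))) tail-sum ⟩
      1ℚ * s (suc m) + ((+ 4 / 1) * (1ℚ * s (2 ℕ.+ m)) + ((+ 4 / 5) * (1ℚ * s (suc m)) + (2ℚ * (odd (2 ℕ.+ m) * s (2 ℕ.+ m)) - s (suc m))))
        -- By s (m+1) ≤ 5 s (m+2) the excess is at most 4 + (4/5) · 5 = 8 times s (m+2), exactly the
        -- growth 2 (odd (m+4) - odd (m+2)).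
        ≤⟨ ≤-surplus (0≤* {+ 4 / 5} (ℚ.nonNegative⁻¹ (+ 4 / 5)) (p≤q⇒0≤q-p (s-ratio-lower m))) (collect (odd (2 ℕ.+ m)) (s (suc m)) (s (2 ℕ.+ m))) ⟩
      2ℚ * ((2ℚ + (2ℚ + odd (2 ℕ.+ m))) * s (2 ℕ.+ m))
        ≡⟨ cong (λ o → 2ℚ * (o * s (2 ℕ.+ m))) (trans (odd-suc (3 ℕ.+ m)) (cong (λ o → 2ℚ + o) (odd-suc (2 ℕ.+ m)))) ⟨
      2ℚ * (odd (4 ℕ.+ m) * s (2 ℕ.+ m)) ∎)
      where
      24ℚ = + 24 / 1
      pull : ∀ o x → 2ℚ * (o * ((+ 24 / 1) * x)) ≡ (+ 24 / 1) * (2ℚ * (o * x))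
      pull = solve-∀ ℚ-ring
      expand′ : ∀ a b e x y z w → (+ 24 / 1) * (a * x + (b * y + (e * z + w)))
        ≡ a * ((+ 24 / 1) * x) + ((+ 4 / 1) * ((+ 6 / 1) * b * y) + ((+ 4 / 5) * ((+ 30 / 1) * e * z) + (+ 24 / 1) * w))
      expand′ = solve-∀ ℚ-ring
      collect : ∀ o z y → 1ℚ * z + ((+ 4 / 1) * (1ℚ * y) + ((+ 4 / 5) * (1ℚ * z) + (2ℚ * (o * y) - z)))
        + (+ 4 / 5) * ((+ 5 / 1) * y - z) ≡ 2ℚ * ((2ℚ + (2ℚ + o)) * y)
      collect = solve-∀ ℚ-ring
      undo : ∀ x y → x ≡ y + x - y
      undo = solve-∀ ℚ-ring
      tail-sum : conv (s ∘ suc) s (suc m) ≡ 2ℚ * (odd (2 ℕ.+ m) * s (2 ℕ.+ m)) - s (suc m)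
      tail-sum = trans (undo (conv (s ∘ suc) s (suc m)) (s (suc m)))
        (cong (_- s (suc m)) (trans (sym (s-split₁ (suc m))) (sym (s-rec (suc m)))))
      tail : 24ℚ * conv (s ∘ suc ∘ suc ∘ suc) s (suc m) ≤ conv (s ∘ suc) s (suc m)
      tail = ℚ.≤-trans (ℚ.≤-reflexive (sym (conv-*ˡ 24ℚ (s ∘ suc ∘ suc ∘ suc) s (suc m))))
        (conv-monoˡ (suc m) 0≤s (λ i i≤m → go k (suc i) (ℕ.≤-<-trans i≤m n<k)))

-- Consequences of the recursion for cd-words

deg-++ : ∀ u v → deg (u ++ v) ≡ deg u ℕ.+ deg v
deg-++ []      v = refl
deg-++ (c ∷ u) v = cong suc (deg-++ u v)
deg-++ (d ∷ u) v = cong (suc ∘ suc) (deg-++ u v)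

deg-dPow : ∀ n → deg (dPow n) ≡ n ℕ.+ n
deg-dPow zero    = refl
deg-dPow (suc n) = cong suc (trans (cong suc (deg-dPow n)) (sym (ℕ.+-suc n n)))

0≤ifEmpty : ∀ v → 0ℚ ≤ ifEmpty v
0≤ifEmpty []      = ℚ.nonNegative⁻¹ 1ℚ
0≤ifEmpty (_ ∷ _) = ℚ.≤-refl

ifEmpty-++ : ∀ u s v → ifEmpty (u ++ s ∷ v) ≡ 0ℚ
ifEmpty-++ []      s v = refl
ifEmpty-++ (_ ∷ u) s v = refl

NoInitialC : List CD → Set
NoInitialC []      = ⊤
NoInitialC (c ∷ v) = ⊥
NoInitialC (d ∷ v) = ⊤

dPow-NoInitialC : ∀ n → NoInitialC (dPow n)
dPow-NoInitialC zero    = tt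
dPow-NoInitialC (suc n) = tt

module Inequalities (e : List CD → ℚ) (riccati : Riccati e) where

  riccati-≤ : ∀ u v → deg u ≡ deg v → cdEnds e u + cdSplits e e u ≤ cdEnds e v + cdSplits e e v → e u ≤ e v
  riccati-≤ u v |u|≡|v| h = 2ι-cancel-≤ (deg v) (begin
    2ℚ * (ι (suc (deg v)) * e u)       ≡⟨ cong (λ n → 2ℚ * (ι (suc n) * e u)) |u|≡|v| ⟨
    2ℚ * (ι (suc (deg u)) * e u)       ≡⟨ riccati u ⟩
    cdEnds e u + cdSplits e e u        ≤⟨ h ⟩
    cdEnds e v + cdSplits e e v        ≡⟨ riccati v ⟨
    2ℚ * (ι (suc (deg v)) * e v)       ∎)
    where open ℚ.≤-Reasoning

  e-[] : e [] ≡ 1ℚ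
  e-[] = 2ι-cancel 0 (begin
    2ℚ * (ι 1 * e [])   ≡⟨ riccati [] ⟩
    2ℚ * (1ℚ * 1ℚ)      ≡⟨ cong (λ x → 2ℚ * (x * 1ℚ)) (fromℤ-/1 (+ 1)) ⟨
    2ℚ * (ι 1 * 1ℚ)     ∎)
    where open ≡-Reasoning

  cdSplits-nonNeg : ∀ v y → (∀ x → deg x ℕ.< deg v → 0ℚ ≤ e x) → (∀ x → deg x ℕ.< deg v → 0ℚ ≤ y x) →
    0ℚ ≤ cdSplits e y v
  cdSplits-nonNeg []      y 0≤e 0≤y = ℚ.≤-refl
  cdSplits-nonNeg (c ∷ v) y 0≤e 0≤y = 0≤+ (0≤* (0≤ifEmpty v) (0≤y [] (s≤s z≤n)))
    (cdSplits-nonNeg v (y ∘ (c ∷_)) (λ x l → 0≤e x (ℕ.m≤n⇒m≤1+n l)) (λ x l → 0≤y (c ∷ x) (s≤s l)))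
  cdSplits-nonNeg (d ∷ v) y 0≤e 0≤y = 0≤+ (0≤* (0≤e v (ℕ.m≤n⇒m≤1+n ℕ.≤-refl)) (0≤y [] (s≤s z≤n)))
    (cdSplits-nonNeg v (y ∘ (d ∷_)) (λ x l → 0≤e x (ℕ.m≤n⇒m≤1+n (ℕ.m≤n⇒m≤1+n l))) (λ x l → 0≤y (d ∷ x) (s≤s (s≤s l))))

  e-nonNeg : ∀ v → 0ℚ ≤ e v
  e-nonNeg v = go (suc (deg v)) v ℕ.≤-refl
    where
    open ℚ.≤-Reasoning
    go : ∀ k v → deg v ℕ.< k → 0ℚ ≤ e v
    go (suc k) v (s≤s |v|≤k) = 2ι-cancel-≤ (deg v) (begin
      2ℚ * (ι (suc (deg v)) * 0ℚ)     ≡⟨ zero-mul (ι (suc (deg v))) ⟩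
      0ℚ                              ≤⟨ 0≤+ (ends-nonNeg v |v|≤k) (cdSplits-nonNeg v e ih ih) ⟩
      cdEnds e v + cdSplits e e v     ≡⟨ riccati v ⟨
      2ℚ * (ι (suc (deg v)) * e v)    ∎)
      where
      zero-mul : ∀ x → 2ℚ * (x * 0ℚ) ≡ 0ℚ
      zero-mul = solve-∀ ℚ-ring
      ih : ∀ x → deg x ℕ.< deg v → 0ℚ ≤ e x
      ih x l = go k x (ℕ.<-≤-trans l |v|≤k)
      ends-nonNeg : ∀ v → deg v ℕ.≤ k → 0ℚ ≤ cdEnds e v
      ends-nonNeg []      _ = ℚ.nonNegative⁻¹ 2ℚ
      ends-nonNeg (c ∷ v) l = go k v l
      ends-nonNeg (d ∷ v) _ = ℚ.≤-refl

  cdEnds-nonNeg : ∀ v → 0ℚ ≤ cdEnds e v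
  cdEnds-nonNeg []      = ℚ.nonNegative⁻¹ 2ℚ
  cdEnds-nonNeg (c ∷ v) = e-nonNeg v
  cdEnds-nonNeg (d ∷ v) = ℚ.≤-refl

  cdSplits-mono : ∀ v {y z} → (∀ x → deg x ℕ.< deg v → y x ≤ z x) → cdSplits e y v ≤ cdSplits e z v
  cdSplits-mono []      h = ℚ.≤-refl
  cdSplits-mono (c ∷ v) h = ℚ.+-mono-≤ (*-monoˡ (0≤ifEmpty v) (h [] (s≤s z≤n)))
    (cdSplits-mono v (λ x l → h (c ∷ x) (s≤s l)))
  cdSplits-mono (d ∷ v) h = ℚ.+-mono-≤ (*-monoˡ (e-nonNeg v) (h [] (s≤s z≤n)))
    (cdSplits-mono v (λ x l → h (d ∷ x) (s≤s (s≤s l))))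

  cdSplits-scale : ∀ k l v {y z} → (∀ x → deg x ℕ.< deg v → k * y x ≡ l * z x) →
    k * cdSplits e y v ≡ l * cdSplits e z v
  cdSplits-scale k l []      h = trans (ℚ.*-zeroʳ k) (sym (ℚ.*-zeroʳ l))
  cdSplits-scale k l (c ∷ v) {y} {z} h = trans (rearr k (ifEmpty v) (y []) (cdSplits e (y ∘ (c ∷_)) v))
    (trans (cong₂ (λ p q → ifEmpty v * p + q) (h [] (s≤s z≤n)) (cdSplits-scale k l v (λ x l → h (c ∷ x) (s≤s l))))
    (sym (rearr l (ifEmpty v) (z []) (cdSplits e (z ∘ (c ∷_)) v))))
    where
    rearr : ∀ k a y x → k * (a * y + x) ≡ a * (k * y) + k * x
    rearr = solve-∀ ℚ-ring
  cdSplits-scale k l (d ∷ v) {y} {z} h = trans (rearr k (e v) (y []) (cdSplits e (y ∘ (d ∷_)) v))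
    (trans (cong₂ (λ p q → e v * p + q) (h [] (s≤s z≤n)) (cdSplits-scale k l v (λ x l → h (d ∷ x) (s≤s (s≤s l)))))
    (sym (rearr l (e v) (z []) (cdSplits e (z ∘ (d ∷_)) v))))
    where
    rearr : ∀ k a y x → k * (a * y + x) ≡ a * (k * y) + k * x
    rearr = solve-∀ ℚ-ring

  -- The appended c adds the summand `y u`. At each letter d of u the right part is lengthened by c,
  -- which does not increase `e`; a former final c of u is no longer last and loses its term.
  cdSplits-snoc : ∀ u y → (∀ x → 0ℚ ≤ y x) → (∀ x → deg x ℕ.< deg u → e (x ++ c ∷ []) ≤ e x) →
    cdSplits e y (u ++ c ∷ []) ≤ cdSplits e y u + y u
  cdSplits-snoc []      y 0≤y h = ℚ.≤-reflexive (swap (y []))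
    where
    swap : ∀ x → 1ℚ * x + 0ℚ ≡ 0ℚ + x
    swap = solve-∀ ℚ-ring
  cdSplits-snoc (c ∷ u) y 0≤y h = begin
    ifEmpty (u ++ c ∷ []) * y [] + cdSplits e yc (u ++ c ∷ [])
      ≤⟨ ℚ.+-mono-≤ (ℚ.≤-reflexive (trans (cong (_* y []) (ifEmpty-++ u c [])) (ℚ.*-zeroˡ (y []))))
           (cdSplits-snoc u yc (λ x → 0≤y (c ∷ x)) (λ x l → h x (ℕ.m≤n⇒m≤1+n l))) ⟩
    0ℚ + (cdSplits e yc u + y (c ∷ u))
      ≤⟨ ℚ.+-monoˡ-≤ (cdSplits e yc u + y (c ∷ u)) (0≤* (0≤ifEmpty u) (0≤y [])) ⟩
    ifEmpty u * y [] + (cdSplits e yc u + y (c ∷ u))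
      ≡⟨ ℚ.+-assoc (ifEmpty u * y []) (cdSplits e yc u) (y (c ∷ u)) ⟨
    ifEmpty u * y [] + cdSplits e yc u + y (c ∷ u) ∎
    where
    open ℚ.≤-Reasoning
    yc = y ∘ (c ∷_)
  cdSplits-snoc (d ∷ u) y 0≤y h = begin
    e (u ++ c ∷ []) * y [] + cdSplits e yd (u ++ c ∷ [])
      ≤⟨ ℚ.+-mono-≤ (*-monoʳ (0≤y []) (h u (ℕ.m≤n⇒m≤1+n ℕ.≤-refl)))
           (cdSplits-snoc u yd (λ x → 0≤y (d ∷ x)) (λ x l → h x (ℕ.m≤n⇒m≤1+n (ℕ.m≤n⇒m≤1+n l)))) ⟩
    e u * y [] + (cdSplits e yd u + y (d ∷ u))
      ≡⟨ ℚ.+-assoc (e u * y []) (cdSplits e yd u) (y (d ∷ u)) ⟨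
    e u * y [] + cdSplits e yd u + y (d ∷ u) ∎
    where
    open ℚ.≤-Reasoning
    yd = y ∘ (d ∷_)

  2ι-suc : ∀ n x → 2ℚ * (ι (suc n) * x) ≡ 2ℚ * (ι n * x) + 2ℚ * x
  2ι-suc n x = trans (cong (λ y → 2ℚ * (y * x)) (ι-suc n)) (rearr (ι n) x)
    where
    rearr : ∀ n x → 2ℚ * ((1ℚ + n) * x) ≡ 2ℚ * (n * x) + 2ℚ * x
    rearr = solve-∀ ℚ-ring

  -- On the right of the recursion the extra c adds at most `e u`, while the factor 2 (deg + 1)
  -- grows by 2. `e-cons` is the same argument at the other end of the word.
  e-snoc : ∀ u → e (u ++ c ∷ []) ≤ e u
  e-snoc u = go (suc (deg u)) u ℕ.≤-refl
    where
    open ℚ.≤-Reasoning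
    go : ∀ k u → deg u ℕ.< k → e (u ++ c ∷ []) ≤ e u
    go (suc k) u (s≤s |u|≤k) = 2ι-cancel-≤ (suc (deg u)) (begin
      2ℚ * (ι (2 ℕ.+ deg u) * e (u ++ c ∷ []))
        ≡⟨ cong (λ n → 2ℚ * (ι (suc n) * e (u ++ c ∷ []))) (trans (deg-++ u (c ∷ [])) (ℕ.+-comm (deg u) 1)) ⟨
      2ℚ * (ι (suc (deg (u ++ c ∷ []))) * e (u ++ c ∷ []))
        ≡⟨ riccati (u ++ c ∷ []) ⟩
      cdEnds e (u ++ c ∷ []) + cdSplits e e (u ++ c ∷ [])
        ≤⟨ ℚ.+-mono-≤ (ends-≤ u |u|≤k) (cdSplits-snoc u e e-nonNeg (λ x l → go k x (ℕ.<-≤-trans l |u|≤k))) ⟩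
      cdEnds e u + (cdSplits e e u + e u)
        ≡⟨ ℚ.+-assoc (cdEnds e u) (cdSplits e e u) (e u) ⟨
      cdEnds e u + cdSplits e e u + e u
        ≡⟨ cong (_+ e u) (riccati u) ⟨
      2ℚ * (ι (suc (deg u)) * e u) + e u
        ≤⟨ ≤-surplus (e-nonNeg u) (rearr (2ℚ * (ι (suc (deg u)) * e u)) (e u)) ⟩
      2ℚ * (ι (suc (deg u)) * e u) + 2ℚ * e u
        ≡⟨ 2ι-suc (suc (deg u)) (e u) ⟨
      2ℚ * (ι (2 ℕ.+ deg u) * e u) ∎)
      where
      rearr : ∀ a x → a + x + x ≡ a + 2ℚ * x
      rearr = solve-∀ ℚ-ring
      ends-≤ : ∀ u → deg u ℕ.≤ k → cdEnds e (u ++ c ∷ []) ≤ cdEnds e u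
      ends-≤ []      _ = ℚ.≤-trans (ℚ.≤-reflexive e-[]) (ℚ.≤ᵇ⇒≤ _)
      ends-≤ (c ∷ u) l = go k u l
      ends-≤ (d ∷ u) _ = ℚ.≤-refl

  e-cons : ∀ u → e (c ∷ u) ≤ e u
  e-cons u = go (suc (deg u)) u ℕ.≤-refl
    where
    open ℚ.≤-Reasoning
    ifEmpty-≤-ends : ∀ u → ifEmpty u * e [] ≤ cdEnds e u
    ifEmpty-≤-ends []      = ℚ.≤-trans (ℚ.≤-reflexive (trans (ℚ.*-identityˡ (e [])) e-[])) (ℚ.≤ᵇ⇒≤ _)
    ifEmpty-≤-ends (s ∷ u) = ℚ.≤-trans (ℚ.≤-reflexive (ℚ.*-zeroˡ (e []))) (cdEnds-nonNeg (s ∷ u))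
    go : ∀ k u → deg u ℕ.< k → e (c ∷ u) ≤ e u
    go (suc k) u (s≤s |u|≤k) = 2ι-cancel-≤ (suc (deg u)) (begin
      2ℚ * (ι (2 ℕ.+ deg u) * e (c ∷ u))
        ≡⟨ riccati (c ∷ u) ⟩
      e u + (ifEmpty u * e [] + cdSplits e (e ∘ (c ∷_)) u)
        ≤⟨ ℚ.+-monoʳ-≤ (e u) (ℚ.+-mono-≤ (ifEmpty-≤-ends u) (cdSplits-mono u (λ x l → go k x (ℕ.<-≤-trans l |u|≤k)))) ⟩
      e u + (cdEnds e u + cdSplits e e u)
        ≡⟨ cong (λ x → e u + x) (riccati u) ⟨
      e u + 2ℚ * (ι (suc (deg u)) * e u)
        ≤⟨ ≤-surplus (e-nonNeg u) (rearr (2ℚ * (ι (suc (deg u)) * e u)) (e u)) ⟩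
      2ℚ * (ι (suc (deg u)) * e u) + 2ℚ * e u
        ≡⟨ 2ι-suc (suc (deg u)) (e u) ⟨
      2ℚ * (ι (2 ℕ.+ deg u) * e u) ∎)
      where
      rearr : ∀ a x → x + a + x ≡ a + 2ℚ * x
      rearr = solve-∀ ℚ-ring

  -- Term by term. The d that replaces cc supplies `e v * y u`; against it stands only the second c,
  -- and only when v is empty, with left part u c.
  cdSplits-cc : ∀ u v y → (∀ x → 0ℚ ≤ y x) → y (u ++ c ∷ []) ≤ y u →
    (∀ x → deg x ℕ.< deg v → y (u ++ c ∷ c ∷ x) ≤ y (u ++ d ∷ x)) →
    (∀ x → deg x ℕ.< deg u → e (x ++ c ∷ c ∷ v) ≤ e (x ++ d ∷ v)) →
    cdSplits e y (u ++ c ∷ c ∷ v) ≤ cdSplits e y (u ++ d ∷ v)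
  cdSplits-cc [] v y 0≤y yc≤y hv hu = begin
    0ℚ * y [] + (ifEmpty v * y (c ∷ []) + cdSplits e (λ x → y (c ∷ c ∷ x)) v)
      ≡⟨ trans (cong (_+ rest) (ℚ.*-zeroˡ (y []))) (ℚ.+-identityˡ rest) ⟩
    ifEmpty v * y (c ∷ []) + cdSplits e (λ x → y (c ∷ c ∷ x)) v
      ≤⟨ ℚ.+-mono-≤ (*-mono (e-nonNeg v) (0≤y (c ∷ [])) (ifEmpty≤e v) yc≤y) (cdSplits-mono v hv) ⟩
    e v * y [] + cdSplits e (λ x → y (d ∷ x)) v ∎
    where
    open ℚ.≤-Reasoning
    rest = ifEmpty v * y (c ∷ []) + cdSplits e (λ x → y (c ∷ c ∷ x)) v
    ifEmpty≤e : ∀ v → ifEmpty v ≤ e v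
    ifEmpty≤e []      = ℚ.≤-reflexive (sym e-[])
    ifEmpty≤e (s ∷ v) = e-nonNeg (s ∷ v)
  cdSplits-cc (c ∷ u) v y 0≤y yc≤y hv hu = ℚ.+-mono-≤
    (ℚ.≤-reflexive (cong (_* y []) (trans (ifEmpty-++ u c (c ∷ v)) (sym (ifEmpty-++ u d v)))))
    (cdSplits-cc u v (y ∘ (c ∷_)) (λ x → 0≤y (c ∷ x)) yc≤y hv (λ x l → hu x (ℕ.m≤n⇒m≤1+n l)))
  cdSplits-cc (d ∷ u) v y 0≤y yc≤y hv hu = ℚ.+-mono-≤
    (*-monoʳ (0≤y []) (hu u (ℕ.m≤n⇒m≤1+n ℕ.≤-refl)))
    (cdSplits-cc u v (y ∘ (d ∷_)) (λ x → 0≤y (d ∷ x)) yc≤y hv (λ x l → hu x (ℕ.m≤n⇒m≤1+n (ℕ.m≤n⇒m≤1+n l))))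

  e-c : 2ℚ * e (c ∷ []) ≡ 1ℚ
  e-c = 2ι-cancel 0 (begin
    2ℚ * (ι 1 * (2ℚ * e (c ∷ [])))       ≡⟨ cong (λ x → 2ℚ * (x * (2ℚ * e (c ∷ [])))) (fromℤ-/1 (+ 1)) ⟩
    2ℚ * (1ℚ * (2ℚ * e (c ∷ [])))        ≡⟨ cong (2ℚ *_) (ℚ.*-identityˡ (2ℚ * e (c ∷ []))) ⟩
    2ℚ * (2ℚ * e (c ∷ []))               ≡⟨ cong (λ x → 2ℚ * (x * e (c ∷ []))) (fromℤ-/1 (+ 2)) ⟨
    2ℚ * (ι 2 * e (c ∷ []))              ≡⟨ riccati (c ∷ []) ⟩
    e [] + (1ℚ * e [] + 0ℚ)              ≡⟨ cong (λ x → x + (1ℚ * x + 0ℚ)) e-[] ⟩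
    2ℚ * (1ℚ * 1ℚ)                       ≡⟨ cong (λ x → 2ℚ * (x * 1ℚ)) (fromℤ-/1 (+ 1)) ⟨
    2ℚ * (ι 1 * 1ℚ)                      ∎)
    where open ≡-Reasoning

  e-cc≤d : ∀ u v → e (u ++ c ∷ c ∷ v) ≤ e (u ++ d ∷ v)
  e-cc≤d u v = go (suc (deg u ℕ.+ deg v)) u v ℕ.≤-refl
    where
    open ℚ.≤-Reasoning
    same-deg : ∀ u v → deg (u ++ c ∷ c ∷ v) ≡ deg (u ++ d ∷ v)
    same-deg u v = trans (deg-++ u (c ∷ c ∷ v)) (sym (deg-++ u (d ∷ v)))
    go : ∀ k u v → deg u ℕ.+ deg v ℕ.< k → e (u ++ c ∷ c ∷ v) ≤ e (u ++ d ∷ v)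
    -- For cc against d the initial and the final c both count and give 2 e(c), while d gives e [] ·
    -- e []; both are 1, so there is equality.
    go (suc k) [] [] _ = riccati-≤ (c ∷ c ∷ []) (d ∷ []) refl (begin
      e (c ∷ []) + (0ℚ * e [] + (1ℚ * e (c ∷ []) + 0ℚ))   ≡⟨ rearr (e (c ∷ [])) (e []) ⟩
      0ℚ + (2ℚ * e (c ∷ []) * 1ℚ + 0ℚ)                    ≡⟨ cong₂ (λ x y → 0ℚ + (x * y + 0ℚ)) e-c (sym e-[]) ⟩
      0ℚ + (1ℚ * e [] + 0ℚ)                               ≡⟨ cong (λ x → 0ℚ + (x * e [] + 0ℚ)) e-[] ⟨
      0ℚ + (e [] * e [] + 0ℚ)                             ∎)
      where
      rearr : ∀ x z → x + (0ℚ * z + (1ℚ * x + 0ℚ)) ≡ 0ℚ + (2ℚ * x * 1ℚ + 0ℚ)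
      rearr = solve-∀ ℚ-ring
    -- Neither c is final now. The initial one contributes `e (c ∷ v)`, and the new d pays for it by
    -- `e-cons`.
    go (suc k) [] v@(s ∷ v′) (s≤s |v|≤k) = riccati-≤ (c ∷ c ∷ v) (d ∷ v) refl (begin
      e (c ∷ v) + (0ℚ * e [] + (0ℚ * e (c ∷ []) + cdSplits e (λ x → e (c ∷ c ∷ x)) v))
        ≡⟨ rearr₁ (e (c ∷ v)) (e []) (e (c ∷ [])) (cdSplits e (λ x → e (c ∷ c ∷ x)) v) ⟩
      0ℚ + (e (c ∷ v) * 1ℚ + cdSplits e (λ x → e (c ∷ c ∷ x)) v)
        ≡⟨ cong (λ x → 0ℚ + (e (c ∷ v) * x + cdSplits e (λ x → e (c ∷ c ∷ x)) v)) e-[] ⟨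
      0ℚ + (e (c ∷ v) * e [] + cdSplits e (λ x → e (c ∷ c ∷ x)) v)
        ≤⟨ ℚ.+-monoʳ-≤ 0ℚ (ℚ.+-mono-≤ (*-monoʳ (e-nonNeg []) (e-cons v))
             (cdSplits-mono v (λ x l → go k [] x (ℕ.<-≤-trans l |v|≤k)))) ⟩
      0ℚ + (e v * e [] + cdSplits e (λ x → e (d ∷ x)) v) ∎)
      where
      rearr₁ : ∀ x y z t → x + (0ℚ * y + (0ℚ * z + t)) ≡ 0ℚ + (x * 1ℚ + t)
      rearr₁ = solve-∀ ℚ-ring
    -- With u nonempty the `cdEnds` terms compare by induction, so the new d has to pay only for a
    -- possible final c.
    go (suc k) u@(s ∷ u′) v (s≤s l) = riccati-≤ (u ++ c ∷ c ∷ v) (u ++ d ∷ v) (same-deg u v)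
      (ℚ.+-mono-≤ (ends-≤ s u′ l) (cdSplits-cc u v e e-nonNeg (e-snoc u)
        (λ x x<v → go k u x (ℕ.<-≤-trans (ℕ.+-monoʳ-< (deg u) x<v) l))
        (λ x x<u → go k x v (ℕ.<-≤-trans (ℕ.+-monoˡ-< (deg v) x<u) l))))
      where
      ends-≤ : ∀ s u → deg (s ∷ u) ℕ.+ deg v ℕ.≤ k → cdEnds e (s ∷ u ++ c ∷ c ∷ v) ≤ cdEnds e (s ∷ u ++ d ∷ v)
      ends-≤ c u l = go k u v l
      ends-≤ d u l = ℚ.≤-refl

  -- Splitting at a letter of dᵃ leaves a right part dⁱ c v with i < a, which `h` factors; the
  -- middle c counts only if it is the last letter; the remaining splits lie in v.
  cdSplits-dPow-c : ∀ a v y → (∀ i → i ℕ.< a → 2ℚ * e (dPow i ++ c ∷ v) ≡ e (dPow i) * e v) →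
    2ℚ * cdSplits e y (dPow a ++ c ∷ v)
      ≡ cdSplits e y (dPow a) * e v + 2ℚ * (ifEmpty v * y (dPow a) + cdSplits e (λ x → y (dPow a ++ c ∷ x)) v)
  cdSplits-dPow-c zero    v y h = pad (2ℚ * (ifEmpty v * y [] + cdSplits e (λ x → y (c ∷ x)) v)) (e v)
    where
    pad : ∀ x z → x ≡ 0ℚ * z + x
    pad = solve-∀ ℚ-ring
  cdSplits-dPow-c (suc a) v y h = begin
    2ℚ * (e (dPow a ++ c ∷ v) * y [] + cdSplits e yd (dPow a ++ c ∷ v))
      ≡⟨ rearr₁ (e (dPow a ++ c ∷ v)) (y []) (cdSplits e yd (dPow a ++ c ∷ v)) ⟩
    2ℚ * e (dPow a ++ c ∷ v) * y [] + 2ℚ * cdSplits e yd (dPow a ++ c ∷ v)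
      ≡⟨ cong₂ (λ p q → p * y [] + q) (h a ℕ.≤-refl) (cdSplits-dPow-c a v yd (λ i l → h i (ℕ.m≤n⇒m≤1+n l))) ⟩
    e (dPow a) * e v * y [] + (cdSplits e yd (dPow a) * e v + 2ℚ * rest)
      ≡⟨ rearr₂ (e (dPow a)) (e v) (y []) (cdSplits e yd (dPow a)) (2ℚ * rest) ⟩
    (e (dPow a) * y [] + cdSplits e yd (dPow a)) * e v + 2ℚ * rest ∎
    where
    open ≡-Reasoning
    yd = y ∘ (d ∷_)
    rest = ifEmpty v * y (dPow (suc a)) + cdSplits e (λ x → y (dPow (suc a) ++ c ∷ x)) v
    rearr₁ : ∀ x y z → 2ℚ * (x * y + z) ≡ 2ℚ * x * y + 2ℚ * z
    rearr₁ = solve-∀ ℚ-ring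
    rearr₂ : ∀ x v y z r → x * v * y + (z * v + r) ≡ (x * y + z) * v + r
    rearr₂ = solve-∀ ℚ-ring

  -- By additivity of deg + 1 and the Leibniz rule, e(dᵃ) e(v) satisfies the recursion of 2 e(dᵃ c
  -- v), each d lying in one of the two factors. An initial c of v would contribute a `cdEnds` term
  -- without counterpart: 2 e(cc) = 1/3, but e [] · e(c) = 1/2.
  e-dPow-c : ∀ a v → NoInitialC v → 2ℚ * e (dPow a ++ c ∷ v) ≡ e (dPow a) * e v
  e-dPow-c a v = go (suc (a ℕ.+ deg v)) a v ℕ.≤-refl
    where
    open ≡-Reasoning
    go : ∀ k a v → a ℕ.+ deg v ℕ.< k → NoInitialC v → 2ℚ * e (dPow a ++ c ∷ v) ≡ e (dPow a) * e v
    go (suc k) a v (s≤s l) v-ok = 2ι-cancel (suc (deg (dPow a) ℕ.+ deg v)) (begin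
      2ℚ * (ι (2 ℕ.+ (deg (dPow a) ℕ.+ deg v)) * (2ℚ * e w))
        ≡⟨ cong (λ n → 2ℚ * (ι (suc n) * (2ℚ * e w))) (trans (deg-++ (dPow a) (c ∷ v)) (ℕ.+-suc (deg (dPow a)) (deg v))) ⟨
      2ℚ * (ι (suc (deg w)) * (2ℚ * e w))
        ≡⟨ rearr₁ (ι (suc (deg w))) (e w) ⟩
      2ℚ * (2ℚ * (ι (suc (deg w)) * e w))
        ≡⟨ cong (2ℚ *_) (riccati w) ⟩
      2ℚ * (cdEnds e w + cdSplits e e w)
        ≡⟨ ℚ.*-distribˡ-+ 2ℚ (cdEnds e w) (cdSplits e e w) ⟩
      2ℚ * cdEnds e w + 2ℚ * cdSplits e e w
        ≡⟨ cong₂ _+_ (ends-eq a) (trans (cdSplits-dPow-c a v e (λ i i<a → go k i v (ℕ.<-≤-trans (ℕ.+-monoˡ-< (deg v) i<a) l) v-ok))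
             (cong (λ x → cdSplits e e (dPow a) * e v + x) (right v v-ok l))) ⟩
      cdEnds e (dPow a) * e v + (cdSplits e e (dPow a) * e v + e (dPow a) * (cdEnds e v + cdSplits e e v))
        ≡⟨ rearr₂ (cdEnds e (dPow a)) (cdSplits e e (dPow a)) (e v) (e (dPow a)) (cdEnds e v + cdSplits e e v) ⟩
      (cdEnds e (dPow a) + cdSplits e e (dPow a)) * e v + e (dPow a) * (cdEnds e v + cdSplits e e v)
        ≡⟨ cong₂ (λ x y → x * e v + e (dPow a) * y) (riccati (dPow a)) (riccati v) ⟨
      2ℚ * (ι (suc (deg (dPow a))) * e (dPow a)) * e v + e (dPow a) * (2ℚ * (ι (suc (deg v)) * e v))
        ≡⟨ rearr₃ (ι (suc (deg (dPow a)))) (ι (suc (deg v))) (e (dPow a)) (e v) ⟩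
      2ℚ * ((ι (suc (deg (dPow a))) + ι (suc (deg v))) * (e (dPow a) * e v))
        ≡⟨ cong (λ x → 2ℚ * (x * (e (dPow a) * e v))) (trans (cong ι (sym (ℕ.+-suc (suc (deg (dPow a))) (deg v)))) (ι-+ (suc (deg (dPow a))) (suc (deg v)))) ⟨
      2ℚ * (ι (2 ℕ.+ (deg (dPow a) ℕ.+ deg v)) * (e (dPow a) * e v)) ∎)
      where
      w = dPow a ++ c ∷ v
      rearr₁ : ∀ n x → 2ℚ * (n * (2ℚ * x)) ≡ 2ℚ * (2ℚ * (n * x))
      rearr₁ = solve-∀ ℚ-ring
      rearr₂ : ∀ p q v a r → p * v + (q * v + a * r) ≡ (p + q) * v + a * r
      rearr₂ = solve-∀ ℚ-ring
      rearr₃ : ∀ m n x y → 2ℚ * (m * x) * y + x * (2ℚ * (n * y)) ≡ 2ℚ * ((m + n) * (x * y))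
      rearr₃ = solve-∀ ℚ-ring
      ends-eq : ∀ a → 2ℚ * cdEnds e (dPow a ++ c ∷ v) ≡ cdEnds e (dPow a) * e v
      ends-eq zero    = refl
      ends-eq (suc a) = trans (ℚ.*-zeroʳ 2ℚ) (sym (ℚ.*-zeroˡ (e v)))
      right : ∀ v → NoInitialC v → a ℕ.+ deg v ℕ.≤ k →
        2ℚ * (ifEmpty v * e (dPow a) + cdSplits e (λ x → e (dPow a ++ c ∷ x)) v) ≡ e (dPow a) * (cdEnds e v + cdSplits e e v)
      -- For empty v the middle c is final, and its term corresponds to the constant 2 in
      -- `cdEnds e []`.
      right []      _ _ = rearr (e (dPow a))
        where
        rearr : ∀ x → 2ℚ * (1ℚ * x + 0ℚ) ≡ x * (2ℚ + 0ℚ)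
        rearr = solve-∀ ℚ-ring
      right (d ∷ v) _ l = begin
        2ℚ * (0ℚ * e (dPow a) + (e v * e (dPow a ++ c ∷ []) + S₁))
          ≡⟨ rearr (e (dPow a)) (e v) (e (dPow a ++ c ∷ [])) S₁ ⟩
        e v * (2ℚ * e (dPow a ++ c ∷ [])) + 2ℚ * S₁
          ≡⟨ cong₂ (λ x y → e v * x + y)
               (go k a [] (ℕ.<-≤-trans (ℕ.+-monoʳ-< a (s≤s z≤n)) l) tt)
               (cdSplits-scale 2ℚ (e (dPow a)) v {z = λ x → e (d ∷ x)}
                 (λ x x<v → go k a (d ∷ x) (ℕ.<-≤-trans (ℕ.+-monoʳ-< a (s≤s (s≤s x<v))) l) tt)) ⟩
        e v * (e (dPow a) * e []) + e (dPow a) * S₂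
          ≡⟨ rearr′ (e (dPow a)) (e v) (e []) S₂ ⟩
        e (dPow a) * (0ℚ + (e v * e [] + S₂)) ∎
        where
        S₁ = cdSplits e (λ x → e (dPow a ++ c ∷ d ∷ x)) v
        S₂ = cdSplits e (λ x → e (d ∷ x)) v
        rearr : ∀ a v x s → 2ℚ * (0ℚ * a + (v * x + s)) ≡ v * (2ℚ * x) + 2ℚ * s
        rearr = solve-∀ ℚ-ring
        rearr′ : ∀ a v x s → v * (a * x) + a * s ≡ a * (0ℚ + (v * x + s))
        rearr′ = solve-∀ ℚ-ring

-- The maximum

-- dᵃ c dᵇ¹ c dᵇ² c …; it has no factor cc iff all inner exponents are positive.
word : ℕ → List ℕ → List CD
word a []       = dPow a
word a (b ∷ bs) = dPow a ++ c ∷ word b bs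

-- Every exponent but the last stands between two letters c, so positivity there excludes cc; the
-- last one follows the final c and may be zero.
AllButLastPositive : List ℕ → Set
AllButLastPositive []            = ⊤
AllButLastPositive (b ∷ [])      = ⊤
AllButLastPositive (b ∷ b′ ∷ bs) = 1 ℕ.≤ b × AllButLastPositive (b′ ∷ bs)

AllButLastPositive-tail : ∀ b bs → AllButLastPositive (b ∷ bs) → AllButLastPositive bs
AllButLastPositive-tail b []       _       = tt
AllButLastPositive-tail b (_ ∷ bs) (_ , p) = p

AllButLastPositive-cons : ∀ b bs → AllButLastPositive bs → AllButLastPositive (suc b ∷ bs)
AllButLastPositive-cons b []       _ = tt
AllButLastPositive-cons b (_ ∷ bs) p = s≤s z≤n , p

word-NoInitialC : ∀ b bs → AllButLastPositive (b ∷ bs) → NoInitialC (word b bs)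
word-NoInitialC b       []       _       = dPow-NoInitialC b
word-NoInitialC (suc b) (_ ∷ bs) _       = tt

deg-word : ∀ a b bs → deg (word a (b ∷ bs)) ≡ a ℕ.+ a ℕ.+ suc (deg (word b bs))
deg-word a b bs = trans (deg-++ (dPow a) (c ∷ word b bs)) (cong (ℕ._+ suc (deg (word b bs))) (deg-dPow a))

module Maximum (e : List CD → ℚ) (riccati : Riccati e) where

  open Inequalities e riccati

  s : ℕ → ℚ
  s n = e (dPow n)

  0≤s : ∀ n → 0ℚ ≤ s n
  0≤s n = e-nonNeg (dPow n)

  cdSplits-conv : ∀ y n → cdSplits e y (dPow n) ≡ conv (y ∘ dPow) s n
  cdSplits-conv y zero    = refl
  cdSplits-conv y (suc n) = cong₂ _+_ (ℚ.*-comm (s n) (y [])) (cdSplits-conv (y ∘ (d ∷_)) n)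

  s-rec : ∀ n → 2ℚ * (odd (suc n) * s (suc n)) ≡ conv s s (suc n)
  s-rec n = begin
    2ℚ * (odd (suc n) * s (suc n))                     ≡⟨ cong (λ x → 2ℚ * (x * s (suc n))) (ι-odd (suc n)) ⟨
    2ℚ * (ι (suc (suc n ℕ.+ suc n)) * s (suc n))       ≡⟨ cong (λ m → 2ℚ * (ι (suc m) * s (suc n))) (deg-dPow (suc n)) ⟨
    2ℚ * (ι (suc (deg (dPow (suc n)))) * s (suc n))    ≡⟨ riccati (dPow (suc n)) ⟩
    0ℚ + cdSplits e e (dPow (suc n))                   ≡⟨ ℚ.+-identityˡ (cdSplits e e (dPow (suc n))) ⟩
    cdSplits e e (dPow (suc n))                        ≡⟨ cdSplits-conv e (suc n) ⟩
    conv s s (suc n)                                   ∎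
    where open ≡-Reasoning

  open Tangent s 0≤s e-[] s-rec

  val : ℕ → List ℕ → ℚ
  val a []       = s a
  val a (b ∷ bs) = ½ * (s a * val b bs)

  0≤val : ∀ a bs → 0ℚ ≤ val a bs
  0≤val a []       = 0≤s a
  0≤val a (b ∷ bs) = 0≤* {½} (ℚ.nonNegative⁻¹ ½) (0≤* (0≤s a) (0≤val b bs))

  ½-mono : ∀ {p q} → p ≤ q → ½ * p ≤ ½ * q
  ½-mono = *-monoˡ {½} (ℚ.nonNegative⁻¹ ½)

  e-word : ∀ a bs → AllButLastPositive bs → e (word a bs) ≡ val a bs
  e-word a []       _ = refl
  e-word a (b ∷ bs) p = begin
    e (word a (b ∷ bs))               ≡⟨ halve (e (word a (b ∷ bs))) ⟩
    ½ * (2ℚ * e (word a (b ∷ bs)))    ≡⟨ cong (½ *_) (e-dPow-c a (word b bs) (word-NoInitialC b bs p)) ⟩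
    ½ * (s a * e (word b bs))         ≡⟨ cong (λ x → ½ * (s a * x)) (e-word b bs (AllButLastPositive-tail b bs p)) ⟩
    ½ * (s a * val b bs)              ∎
    where
    open ≡-Reasoning
    halve : ∀ x → x ≡ ½ * (2ℚ * x)
    halve = solve-∀ ℚ-ring

  -- The bound is required in every left context u, because `mergeCC` works from the right end and
  -- later puts further letters in front.
  record Blocks (v : List CD) : Set where
    constructor blocks
    field
      first    : ℕ
      others   : List ℕ
      positive : AllButLastPositive others
      degree   : deg v ≡ deg (word first others)
      bound    : ∀ u → e (u ++ v) ≤ e (u ++ word first others)

  mergeCC : ∀ v → Blocks v
  mergeCC []      = blocks 0 [] tt refl (λ u → ℚ.≤-refl)
  mergeCC (d ∷ v) with mergeCC v
  ... | blocks a []       p g h = blocks (suc a) [] p (cong (suc ∘ suc) g)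
        (λ u → subst₂ (λ x y → e x ≤ e y) (++-assoc u (d ∷ []) v) (++-assoc u (d ∷ []) (dPow a)) (h (u ++ d ∷ [])))
  ... | blocks a (b ∷ bs) p g h = blocks (suc a) (b ∷ bs) p (cong (suc ∘ suc) g)
        (λ u → subst₂ (λ x y → e x ≤ e y) (++-assoc u (d ∷ []) v) (++-assoc u (d ∷ []) (word a (b ∷ bs))) (h (u ++ d ∷ [])))
  mergeCC (c ∷ v) with mergeCC v
  ... | blocks (suc a) bs p g h = blocks 0 (suc a ∷ bs) (AllButLastPositive-cons a bs p) (cong suc g)
        (λ u → subst₂ (λ x y → e x ≤ e y) (++-assoc u (c ∷ []) v) (++-assoc u (c ∷ []) (word (suc a) bs)) (h (u ++ c ∷ [])))
  ... | blocks zero [] p g h = blocks 0 (0 ∷ []) tt (cong suc g)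
        (λ u → subst₂ (λ x y → e x ≤ e y) (++-assoc u (c ∷ []) v) (++-assoc u (c ∷ []) []) (h (u ++ c ∷ [])))
  -- The word found for v begins with c, so the new c creates cc, which becomes d. The result begins
  -- with d, hence one pass suffices.
  ... | blocks zero (b ∷ bs) p g h = blocks (suc b) bs (AllButLastPositive-tail b bs p) (trans (cong suc g) (deg-d∷ b bs))
        (λ u → ℚ.≤-trans
          (subst₂ (λ x y → e x ≤ e y) (++-assoc u (c ∷ []) v) (++-assoc u (c ∷ []) (c ∷ word b bs)) (h (u ++ c ∷ [])))
          (subst (λ x → e (u ++ c ∷ c ∷ word b bs) ≤ e (u ++ x)) (d∷word b bs) (e-cc≤d u (word b bs))))
    where
    d∷word : ∀ b bs → d ∷ word b bs ≡ word (suc b) bs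
    d∷word b []       = refl
    d∷word b (_ ∷ bs) = refl
    deg-d∷ : ∀ b bs → suc (suc (deg (word b bs))) ≡ deg (word (suc b) bs)
    deg-d∷ b bs = cong deg (d∷word b bs)

  -- Two uses of `s-supermul₁` gain 36 and end at index k + m + n + 1; three ratio steps at a cost
  -- of 5 each raise the index to k + m + n + 4.
  triple-≤ : ∀ k m n → (+ 36 / 1) * (s (suc k) * (s (suc m) * s (suc n))) ≤ (+ 125 / 1) * s (4 ℕ.+ (k ℕ.+ m ℕ.+ n))
  triple-≤ k m n = begin
    (+ 36 / 1) * (s (suc k) * (s (suc m) * s (suc n)))
      ≡⟨ rearr₁ (s (suc k)) (s (suc m)) (s (suc n)) ⟩
    (+ 6 / 1) * ((+ 6 / 1) * (s (suc k) * s (suc m)) * s (suc n))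
      ≤⟨ *-monoˡ {+ 6 / 1} (ℚ.nonNegative⁻¹ (+ 6 / 1)) (*-monoʳ (0≤s (suc n)) (s-supermul₁ k m)) ⟩
    (+ 6 / 1) * (s (suc (k ℕ.+ m)) * s (suc n))
      ≤⟨ s-supermul₁ (k ℕ.+ m) n ⟩
    s (suc l)
      ≤⟨ s-ratio-lower l ⟩
    5ℚ * s (2 ℕ.+ l)
      ≤⟨ *-monoˡ {5ℚ} (ℚ.nonNegative⁻¹ 5ℚ) (ℚ.≤-trans (s-ratio-lower (suc l)) (*-monoˡ {5ℚ} (ℚ.nonNegative⁻¹ 5ℚ) (s-ratio-lower (2 ℕ.+ l)))) ⟩
    5ℚ * (5ℚ * (5ℚ * s (4 ℕ.+ l)))
      ≡⟨ rearr₂ (s (4 ℕ.+ l)) ⟩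
    (+ 125 / 1) * s (4 ℕ.+ l) ∎
    where
    open ℚ.≤-Reasoning
    5ℚ = + 5 / 1
    l = k ℕ.+ m ℕ.+ n
    rearr₁ : ∀ x y z → (+ 36 / 1) * (x * (y * z)) ≡ (+ 6 / 1) * ((+ 6 / 1) * (x * y) * z)
    rearr₁ = solve-∀ ℚ-ring
    rearr₂ : ∀ x → (+ 5 / 1) * ((+ 5 / 1) * ((+ 5 / 1) * x)) ≡ (+ 125 / 1) * x
    rearr₂ = solve-∀ ℚ-ring

  -- Saving two letters c is worth a factor 4, so the comparison is 125 against 36 · 4 = 144.
  val-merge : ∀ k m n b bs →
    val (suc k) (suc m ∷ suc n ∷ b ∷ bs) ≤ val (4 ℕ.+ (k ℕ.+ m ℕ.+ n)) (b ∷ bs)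
  val-merge k m n b bs = begin
    ½ * (s (suc k) * (½ * (s (suc m) * (½ * (s (suc n) * V)))))
      ≡⟨ rearr₁ (s (suc k)) (s (suc m)) (s (suc n)) V ⟩
    ½ * ((+ 1 / 144) * ((+ 36 / 1) * (s (suc k) * (s (suc m) * s (suc n)))) * V)
      ≤⟨ ½-mono (*-monoʳ (0≤val b bs) (*-monoˡ {+ 1 / 144} (ℚ.nonNegative⁻¹ (+ 1 / 144)) (triple-≤ k m n))) ⟩
    ½ * ((+ 1 / 144) * ((+ 125 / 1) * x) * V)
      ≤⟨ ½-mono (*-monoʳ (0≤val b bs) slack) ⟩
    ½ * (x * V) ∎
    where
    open ℚ.≤-Reasoning
    V = val b bs
    x = s (4 ℕ.+ (k ℕ.+ m ℕ.+ n))
    rearr₁ : ∀ x y z v → ½ * (x * (½ * (y * (½ * (z * v))))) ≡ ½ * ((+ 1 / 144) * ((+ 36 / 1) * (x * (y * z))) * v)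
    rearr₁ = solve-∀ ℚ-ring
    rearr₂ : ∀ x → (+ 1 / 144) * ((+ 125 / 1) * x) + (+ 19 / 144) * x ≡ x
    rearr₂ = solve-∀ ℚ-ring
    slack : (+ 1 / 144) * ((+ 125 / 1) * x) ≤ x
    slack = ≤-surplus (0≤* {+ 19 / 144} (ℚ.nonNegative⁻¹ (+ 19 / 144)) (0≤s (4 ℕ.+ (k ℕ.+ m ℕ.+ n)))) (rearr₂ x)

  record Short (b : ℕ) (bs : List ℕ) : Set where
    constructor short
    field
      first    : ℕ
      others   : List ℕ
      length≤2 : length others ℕ.≤ 2
      positive : AllButLastPositive (first ∷ others)
      degree   : deg (word b bs) ≡ deg (word first others)
      bound    : val b bs ≤ val first others

  -- Replacing three positive inner exponents k, m, n by k + m + n + 1 keeps the degree and saves two letters c.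
  mergeTriples : ∀ b bs → AllButLastPositive (b ∷ bs) → Short b bs
  mergeTriples b []            p = short b [] z≤n p refl ℚ.≤-refl
  mergeTriples b (b₂ ∷ [])      p = short b (b₂ ∷ []) (s≤s z≤n) p refl ℚ.≤-refl
  mergeTriples b (b₂ ∷ b₃ ∷ []) p = short b (b₂ ∷ b₃ ∷ []) (s≤s (s≤s z≤n)) p refl ℚ.≤-refl
  mergeTriples (suc k) (suc m ∷ suc n ∷ b ∷ bs) (_ , _ , _ , p)
    with mergeTriples (4 ℕ.+ (k ℕ.+ m ℕ.+ n)) (b ∷ bs) (s≤s z≤n , p)
  ... | short b′ bs′ l p′ g h = short b′ bs′ l p′ (trans same-deg g) (ℚ.≤-trans (val-merge k m n b bs) h)
    where
    open ≡-Reasoning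
    D = deg (word b bs)
    arith : ∀ k m n D → suc k ℕ.+ suc k ℕ.+ suc (suc m ℕ.+ suc m ℕ.+ suc (suc n ℕ.+ suc n ℕ.+ suc D))
      ≡ 4 ℕ.+ (k ℕ.+ m ℕ.+ n) ℕ.+ (4 ℕ.+ (k ℕ.+ m ℕ.+ n)) ℕ.+ suc D
    arith = ℕ-Solver.solve-∀
    same-deg : deg (word (suc k) (suc m ∷ suc n ∷ b ∷ bs)) ≡ deg (word (4 ℕ.+ (k ℕ.+ m ℕ.+ n)) (b ∷ bs))
    same-deg = begin
      deg (word (suc k) (suc m ∷ suc n ∷ b ∷ bs))
        ≡⟨ deg-word (suc k) (suc m) (suc n ∷ b ∷ bs) ⟩
      suc k ℕ.+ suc k ℕ.+ suc (deg (word (suc m) (suc n ∷ b ∷ bs)))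
        ≡⟨ cong (λ x → suc k ℕ.+ suc k ℕ.+ suc x) (deg-word (suc m) (suc n) (b ∷ bs)) ⟩
      suc k ℕ.+ suc k ℕ.+ suc (suc m ℕ.+ suc m ℕ.+ suc (deg (word (suc n) (b ∷ bs))))
        ≡⟨ cong (λ x → suc k ℕ.+ suc k ℕ.+ suc (suc m ℕ.+ suc m ℕ.+ suc x)) (deg-word (suc n) b bs) ⟩
      suc k ℕ.+ suc k ℕ.+ suc (suc m ℕ.+ suc m ℕ.+ suc (suc n ℕ.+ suc n ℕ.+ suc D))
        ≡⟨ arith k m n D ⟩
      4 ℕ.+ (k ℕ.+ m ℕ.+ n) ℕ.+ (4 ℕ.+ (k ℕ.+ m ℕ.+ n)) ℕ.+ suc D
        ≡⟨ deg-word (4 ℕ.+ (k ℕ.+ m ℕ.+ n)) b bs ⟨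
      deg (word (4 ℕ.+ (k ℕ.+ m ℕ.+ n)) (b ∷ bs)) ∎

  -- After both kinds of merging at most three letters c remain, so a bound has to be checked only
  -- on finitely many shapes of products of the numbers s.
  e-≤-val : ∀ (D : ℕ) (M : ℚ) →
    (∀ a → a ℕ.+ a ≡ D → val a [] ≤ M) →
    (∀ a b bs → length bs ℕ.≤ 2 → AllButLastPositive (b ∷ bs) → a ℕ.+ a ℕ.+ suc (deg (word b bs)) ≡ D → val a (b ∷ bs) ≤ M) →
    ∀ v → deg v ≡ D → e v ≤ M
  e-≤-val D M h₀ h₁ v |v|≡D with mergeCC v
  ... | blocks a [] p g h = ℚ.≤-trans (h [])
          (h₀ a (trans (sym (deg-dPow a)) (trans (sym g) |v|≡D)))
  ... | blocks a (b ∷ bs) p g h with mergeTriples b bs p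
  ... | short b′ bs′ l p′ g′ h′ = begin
    e v                      ≤⟨ h [] ⟩
    e (word a (b ∷ bs))      ≡⟨ e-word a (b ∷ bs) p ⟩
    ½ * (s a * val b bs)     ≤⟨ ½-mono (*-monoˡ (0≤s a) h′) ⟩
    ½ * (s a * val b′ bs′)   ≤⟨ h₁ a b′ bs′ l p′ (trans (cong (λ x → a ℕ.+ a ℕ.+ suc x) (sym g′)) (trans (sym (deg-word a b bs)) (trans (sym g) |v|≡D))) ⟩
    M                        ∎
    where open ℚ.≤-Reasoning

  -- The values of `e` at the extremal words. `oddMax` is s 1 · s n / 8 with s 1 = 1/6, written so
  -- that the constants 24 and 6 apply inside the outer ½.
  evenMax oddMax : ℕ → ℚ
  evenMax n = ½ * (½ * s n)
  oddMax n  = ½ * ((+ 1 / 24) * s n)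

  half-double : ∀ {m n} → m ℕ.+ m ≡ n ℕ.+ n → m ≡ n
  half-double {m} {n} h = ℕ.*-cancelˡ-≡ m n 2 (trans (double m) (trans h (sym (double n))))
    where
    double : ∀ m → 2 ℕ.* m ≡ m ℕ.+ m
    double = ℕ-Solver.solve-∀

  double≢suc-double : ∀ m n → m ℕ.+ m ≢ suc (n ℕ.+ n)
  double≢suc-double m n h = ℕ.even≢odd m n (trans (double m) (trans h (cong suc (sym (double n)))))
    where
    double : ∀ m → 2 ℕ.* m ≡ m ℕ.+ m
    double = ℕ-Solver.solve-∀

  e-≤-evenMax : ∀ n → 1 ℕ.≤ n → ∀ v → deg v ≡ 2 ℕ.* n ℕ.+ 2 → e v ≤ evenMax n
  e-≤-evenMax (suc n) _ = e-≤-val (2 ℕ.* suc n ℕ.+ 2) (evenMax (suc n)) no-c some-c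
    where
    open ℚ.≤-Reasoning
    target : ∀ n → 2 ℕ.* suc n ℕ.+ 2 ≡ suc (suc n) ℕ.+ suc (suc n)
    target = ℕ-Solver.solve-∀
    scale₁ : ∀ x → x ≡ (+ 1 / 24) * ((+ 24 / 1) * x)
    scale₁ = solve-∀ ℚ-ring
    scale₂ : ∀ x → (+ 1 / 24) * ((+ 24 / 1) * ((+ 5 / 1) * x)) ≡ (+ 5 / 24) * ((+ 24 / 1) * x)
    scale₂ = solve-∀ ℚ-ring
    scale₃ : ∀ x → (+ 5 / 24) * x + (+ 1 / 24) * x ≡ ½ * (½ * x)
    scale₃ = solve-∀ ℚ-ring
    no-c : ∀ a → a ℕ.+ a ≡ 2 ℕ.* suc n ℕ.+ 2 → s a ≤ evenMax (suc n)
    no-c a h = begin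
      s a
        ≡⟨ cong s (half-double (trans h (target n))) ⟩
      s (2 ℕ.+ n)
        ≡⟨ scale₁ (s (2 ℕ.+ n)) ⟩
      (+ 1 / 24) * ((+ 24 / 1) * s (2 ℕ.+ n))
        -- A single ratio is bounded above by going one step too far: s (n+2) ≤ 5 s (n+3) ≤ (5/24) s
        -- (n+1), and 5/24 < 1/4.
        ≤⟨ *-monoˡ {+ 1 / 24} (ℚ.nonNegative⁻¹ (+ 1 / 24)) (*-monoˡ {+ 24 / 1} (ℚ.nonNegative⁻¹ (+ 24 / 1)) (s-ratio-lower (suc n))) ⟩
      (+ 1 / 24) * ((+ 24 / 1) * ((+ 5 / 1) * s (3 ℕ.+ n)))
        ≡⟨ scale₂ (s (3 ℕ.+ n)) ⟩
      (+ 5 / 24) * ((+ 24 / 1) * s (3 ℕ.+ n))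
        ≤⟨ *-monoˡ {+ 5 / 24} (ℚ.nonNegative⁻¹ (+ 5 / 24)) (s-ratio-upper (suc n)) ⟩
      (+ 5 / 24) * s (suc n)
        ≤⟨ ≤-surplus (0≤* {+ 1 / 24} (ℚ.nonNegative⁻¹ (+ 1 / 24)) (0≤s (suc n))) (scale₃ (s (suc n))) ⟩
      evenMax (suc n) ∎
    some-c : ∀ a b bs → length bs ℕ.≤ 2 → AllButLastPositive (b ∷ bs) →
      a ℕ.+ a ℕ.+ suc (deg (word b bs)) ≡ 2 ℕ.* suc n ℕ.+ 2 → val a (b ∷ bs) ≤ evenMax (suc n)
    -- The number of letters c has the parity of the degree, so one or three of them cannot occur
    -- here.
    some-c a b [] _ _ h = ⊥-elim (double≢suc-double (suc (suc n)) (a ℕ.+ b)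
      (trans (sym (target n)) (trans (sym h) (trans (cong (λ x → a ℕ.+ a ℕ.+ suc x) (deg-dPow b)) (arith a b)))))
      where
      arith : ∀ a b → a ℕ.+ a ℕ.+ suc (b ℕ.+ b) ≡ suc (a ℕ.+ b ℕ.+ (a ℕ.+ b))
      arith = ℕ-Solver.solve-∀
    some-c a b (b₂ ∷ []) _ _ h = begin
      ½ * (s a * (½ * (s b * s b₂)))      ≡⟨ rearr (s a) (s b) (s b₂) ⟩
      ½ * (½ * (s a * (s b * s b₂)))      ≤⟨ ½-mono (½-mono (*-monoˡ (0≤s a) (s-supermul b b₂))) ⟩
      ½ * (½ * (s a * s (b ℕ.+ b₂)))      ≤⟨ ½-mono (½-mono (s-supermul a (b ℕ.+ b₂))) ⟩
      ½ * (½ * s (a ℕ.+ (b ℕ.+ b₂)))      ≡⟨ cong (λ m → ½ * (½ * s m)) total ⟩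
      evenMax (suc n)                     ∎
      where
      rearr : ∀ x y z → ½ * (x * (½ * (y * z))) ≡ ½ * (½ * (x * (y * z)))
      rearr = solve-∀ ℚ-ring
      arith : ∀ a b b₂ → a ℕ.+ a ℕ.+ suc (b ℕ.+ b ℕ.+ suc (b₂ ℕ.+ b₂)) ≡ suc (a ℕ.+ (b ℕ.+ b₂)) ℕ.+ suc (a ℕ.+ (b ℕ.+ b₂))
      arith = ℕ-Solver.solve-∀
      total : a ℕ.+ (b ℕ.+ b₂) ≡ suc n
      total = ℕ.suc-injective (half-double (trans (sym (arith a b b₂))
        (trans (cong (λ x → a ℕ.+ a ℕ.+ suc x) (sym (trans (deg-word b b₂ []) (cong (λ x → b ℕ.+ b ℕ.+ suc x) (deg-dPow b₂)))))
        (trans h (target n)))))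
    some-c a b (b₂ ∷ b₃ ∷ []) _ _ h = ⊥-elim (double≢suc-double (suc (suc n)) (suc (a ℕ.+ b ℕ.+ b₂ ℕ.+ b₃))
      (trans (sym (target n)) (trans (sym h) (trans (cong (λ x → a ℕ.+ a ℕ.+ suc x)
        (trans (deg-word b b₂ (b₃ ∷ [])) (cong (λ x → b ℕ.+ b ℕ.+ suc x)
        (trans (deg-word b₂ b₃ []) (cong (λ x → b₂ ℕ.+ b₂ ℕ.+ suc x) (deg-dPow b₃)))))) (arith a b b₂ b₃)))))
      where
      arith : ∀ a b x y → a ℕ.+ a ℕ.+ suc (b ℕ.+ b ℕ.+ suc (x ℕ.+ x ℕ.+ suc (y ℕ.+ y)))
        ≡ suc (suc (a ℕ.+ b ℕ.+ x ℕ.+ y) ℕ.+ suc (a ℕ.+ b ℕ.+ x ℕ.+ y))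
      arith = ℕ-Solver.solve-∀
    some-c a b (_ ∷ _ ∷ _ ∷ _) (s≤s (s≤s ())) _ h

  e-≤-oddMax : ∀ n → ∀ v → deg v ≡ 2 ℕ.* n ℕ.+ 5 → e v ≤ oddMax n
  e-≤-oddMax n = e-≤-val (2 ℕ.* n ℕ.+ 5) (oddMax n) no-c some-c
    where
    open ℚ.≤-Reasoning
    target : ∀ n → 2 ℕ.* n ℕ.+ 5 ≡ suc (2 ℕ.+ n ℕ.+ (2 ℕ.+ n))
    target = ℕ-Solver.solve-∀
    no-c : ∀ a → a ℕ.+ a ≡ 2 ℕ.* n ℕ.+ 5 → s a ≤ oddMax n
    no-c a h = ⊥-elim (double≢suc-double a (2 ℕ.+ n) (trans h (target n)))
    some-c : ∀ a b bs → length bs ℕ.≤ 2 → AllButLastPositive (b ∷ bs) →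
      a ℕ.+ a ℕ.+ suc (deg (word b bs)) ≡ 2 ℕ.* n ℕ.+ 5 → val a (b ∷ bs) ≤ oddMax n
    some-c a b [] _ _ h = begin
      ½ * (s a * s b)                               ≤⟨ ½-mono (s-supermul a b) ⟩
      ½ * s (a ℕ.+ b)                               ≡⟨ cong (λ m → ½ * s m) total ⟩
      ½ * s (2 ℕ.+ n)                               ≡⟨ cong (½ *_) (scale (s (2 ℕ.+ n))) ⟩
      ½ * ((+ 1 / 24) * ((+ 24 / 1) * s (2 ℕ.+ n))) ≤⟨ ½-mono (*-monoˡ {+ 1 / 24} (ℚ.nonNegative⁻¹ (+ 1 / 24)) (s-ratio-upper n)) ⟩
      oddMax n                                      ∎
      where
      scale : ∀ x → x ≡ (+ 1 / 24) * ((+ 24 / 1) * x)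
      scale = solve-∀ ℚ-ring
      arith : ∀ a b → a ℕ.+ a ℕ.+ suc (b ℕ.+ b) ≡ suc (a ℕ.+ b ℕ.+ (a ℕ.+ b))
      arith = ℕ-Solver.solve-∀
      total : a ℕ.+ b ≡ 2 ℕ.+ n
      total = half-double (ℕ.suc-injective (trans (sym (arith a b))
        (trans (cong (λ x → a ℕ.+ a ℕ.+ suc x) (sym (deg-dPow b))) (trans h (target n)))))
    some-c a b (b₂ ∷ []) _ _ h = ⊥-elim (double≢suc-double (suc (a ℕ.+ b ℕ.+ b₂)) (2 ℕ.+ n)
      (trans (sym (trans (cong (λ x → a ℕ.+ a ℕ.+ suc x)
        (trans (deg-word b b₂ []) (cong (λ x → b ℕ.+ b ℕ.+ suc x) (deg-dPow b₂)))) (arith a b b₂)))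
      (trans h (target n))))
      where
      arith : ∀ a b x → a ℕ.+ a ℕ.+ suc (b ℕ.+ b ℕ.+ suc (x ℕ.+ x)) ≡ suc (a ℕ.+ b ℕ.+ x) ℕ.+ suc (a ℕ.+ b ℕ.+ x)
      arith = ℕ-Solver.solve-∀
    -- Pairing the exponents on either side of the middle c puts one positive inner exponent into
    -- each pair, as `s-supermul₁` requires.
    some-c a (suc b) (suc b₂ ∷ b₃ ∷ []) _ _ h = begin
      ½ * (s a * (½ * (s (suc b) * (½ * (s (suc b₂) * s b₃)))))
        ≡⟨ rearr (s a) (s (suc b)) (s (suc b₂)) (s b₃) ⟩
      ½ * ((+ 1 / 24) * ((+ 6 / 1) * ((s a * s (suc b)) * (s (suc b₂) * s b₃))))
        ≤⟨ ½-mono (*-monoˡ {+ 1 / 24} (ℚ.nonNegative⁻¹ (+ 1 / 24)) (*-monoˡ {+ 6 / 1} (ℚ.nonNegative⁻¹ (+ 6 / 1))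
             (*-mono (0≤s (a ℕ.+ suc b)) (0≤* (0≤s (suc b₂)) (0≤s b₃)) (s-supermul a (suc b)) (s-supermul (suc b₂) b₃)))) ⟩
      ½ * ((+ 1 / 24) * ((+ 6 / 1) * (s (a ℕ.+ suc b) * s (suc b₂ ℕ.+ b₃))))
        ≡⟨ cong (λ m → ½ * ((+ 1 / 24) * ((+ 6 / 1) * (s m * s (suc b₂ ℕ.+ b₃))))) (ℕ.+-suc a b) ⟩
      ½ * ((+ 1 / 24) * ((+ 6 / 1) * (s (suc (a ℕ.+ b)) * s (suc (b₂ ℕ.+ b₃)))))
        ≤⟨ ½-mono (*-monoˡ {+ 1 / 24} (ℚ.nonNegative⁻¹ (+ 1 / 24)) (s-supermul₁ (a ℕ.+ b) (b₂ ℕ.+ b₃))) ⟩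
      ½ * ((+ 1 / 24) * s (suc (a ℕ.+ b ℕ.+ (b₂ ℕ.+ b₃))))
        ≡⟨ cong (λ m → ½ * ((+ 1 / 24) * s m)) total ⟩
      oddMax n ∎
      where
      rearr : ∀ x y z w → ½ * (x * (½ * (y * (½ * (z * w))))) ≡ ½ * ((+ 1 / 24) * ((+ 6 / 1) * ((x * y) * (z * w))))
      rearr = solve-∀ ℚ-ring
      arith : ∀ a b x y → a ℕ.+ a ℕ.+ suc (suc b ℕ.+ suc b ℕ.+ suc (suc x ℕ.+ suc x ℕ.+ suc (y ℕ.+ y)))
        ≡ suc (2 ℕ.+ suc (a ℕ.+ b ℕ.+ (x ℕ.+ y)) ℕ.+ (2 ℕ.+ suc (a ℕ.+ b ℕ.+ (x ℕ.+ y))))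
      arith = ℕ-Solver.solve-∀
      total : suc (a ℕ.+ b ℕ.+ (b₂ ℕ.+ b₃)) ≡ n
      total = ℕ.+-cancelˡ-≡ 2 _ _ (half-double (ℕ.suc-injective (trans (sym (arith a b b₂ b₃))
        (trans (sym (cong (λ x → a ℕ.+ a ℕ.+ suc x)
          (trans (deg-word (suc b) (suc b₂) (b₃ ∷ [])) (cong (λ x → suc b ℕ.+ suc b ℕ.+ suc x)
          (trans (deg-word (suc b₂) b₃ []) (cong (λ x → suc b₂ ℕ.+ suc b₂ ℕ.+ suc x) (deg-dPow b₃)))))))
        (trans h (target n))))))
    some-c a b (_ ∷ _ ∷ _ ∷ _) (s≤s (s≤s ())) _ h

  e-cdⁿc : ∀ n → 1 ℕ.≤ n → e (c ∷ dPow n ++ c ∷ []) ≡ evenMax n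
  e-cdⁿc n 1≤n = trans (e-word 0 (n ∷ 0 ∷ []) (1≤n , tt))
    (trans (cong (λ x → ½ * (x * (½ * (s n * x)))) e-[]) (rearr (s n)))
    where
    rearr : ∀ x → ½ * (1ℚ * (½ * (x * 1ℚ))) ≡ ½ * (½ * x)
    rearr = solve-∀ ℚ-ring

  e-cdcdⁿc : ∀ n → 1 ℕ.≤ n → e (c ∷ d ∷ c ∷ dPow n ++ c ∷ []) ≡ oddMax n
  e-cdcdⁿc n 1≤n = trans (e-word 0 (1 ∷ n ∷ 0 ∷ []) (s≤s z≤n , 1≤n , tt))
    (trans (cong (λ x → ½ * (x * (½ * (s 1 * (½ * (s n * x)))))) e-[])
    (trans (rearr₁ (s 1) (s n)) (trans (cong (λ x → ½ * ((+ 1 / 24) * (x * s n))) s₁) (rearr₂ (s n)))))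
    where
    rearr₁ : ∀ x y → ½ * (1ℚ * (½ * (x * (½ * (y * 1ℚ))))) ≡ ½ * ((+ 1 / 24) * ((+ 6 / 1) * x * y))
    rearr₁ = solve-∀ ℚ-ring
    rearr₂ : ∀ x → ½ * ((+ 1 / 24) * (1ℚ * x)) ≡ ½ * ((+ 1 / 24) * x)
    rearr₂ = solve-∀ ℚ-ring

  e-cdⁿcdc : ∀ n → 1 ℕ.≤ n → e (c ∷ dPow n ++ c ∷ d ∷ c ∷ []) ≡ oddMax n
  e-cdⁿcdc n 1≤n = trans (e-word 0 (n ∷ 1 ∷ 0 ∷ []) (1≤n , s≤s z≤n , tt))
    (trans (cong (λ x → ½ * (x * (½ * (s n * (½ * (s 1 * x)))))) e-[])
    (trans (rearr₁ (s 1) (s n)) (trans (cong (λ x → ½ * ((+ 1 / 24) * (x * s n))) s₁) (rearr₂ (s n)))))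
    where
    rearr₁ : ∀ x y → ½ * (1ℚ * (½ * (y * (½ * (x * 1ℚ))))) ≡ ½ * ((+ 1 / 24) * ((+ 6 / 1) * x * y))
    rearr₁ = solve-∀ ℚ-ring
    rearr₂ : ∀ x → ½ * ((+ 1 / 24) * (1ℚ * x)) ≡ ½ * ((+ 1 / 24) * x)
    rearr₂ = solve-∀ ℚ-ring

-- Degrees of the extremal words and the return to integers

deg-cdⁿc : ∀ n → deg (c ∷ dPow n ++ c ∷ []) ≡ 2 ℕ.* n ℕ.+ 2
deg-cdⁿc n = trans (cong suc (trans (deg-++ (dPow n) (c ∷ [])) (cong (ℕ._+ 1) (deg-dPow n)))) (arith n)
  where
  arith : ∀ n → suc (n ℕ.+ n ℕ.+ 1) ≡ 2 ℕ.* n ℕ.+ 2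
  arith = ℕ-Solver.solve-∀

deg-cdcdⁿc : ∀ n → deg (c ∷ d ∷ c ∷ dPow n ++ c ∷ []) ≡ 2 ℕ.* n ℕ.+ 5
deg-cdcdⁿc n = trans (cong (4 ℕ.+_) (trans (deg-++ (dPow n) (c ∷ [])) (cong (ℕ._+ 1) (deg-dPow n)))) (arith n)
  where
  arith : ∀ n → 4 ℕ.+ (n ℕ.+ n ℕ.+ 1) ≡ 2 ℕ.* n ℕ.+ 5
  arith = ℕ-Solver.solve-∀

deg-cdⁿcdc : ∀ n → deg (c ∷ dPow n ++ c ∷ d ∷ c ∷ []) ≡ 2 ℕ.* n ℕ.+ 5
deg-cdⁿcdc n = trans (cong suc (trans (deg-++ (dPow n) (c ∷ d ∷ c ∷ [])) (cong (ℕ._+ 4) (deg-dPow n)))) (arith n)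
  where
  arith : ∀ n → suc (n ℕ.+ n ℕ.+ 4) ≡ 2 ℕ.* n ℕ.+ 5
  arith = ℕ-Solver.solve-∀

normalise-cancel-≤ : ∀ β v w → deg v ≡ deg w → normalise β v ≤ normalise β w → β v ℤ.≤ β w
normalise-cancel-≤ β v w |v|≡|w| h = fromℤ-cancel-≤ (ℚ.*-cancelʳ-≤-pos (invFact (suc (deg w))) {{invFact-pos (suc (deg w))}}
  (subst (λ n → fromℤ (β v) * invFact (suc n) ≤ normalise β w) |v|≡|w| h))

theorem6p1 : (β : List CD → ℤ) → IsBooleanCDIndex β → (n : ℕ) → 1 ℕ.≤ n →
    ((v : List CD) → deg v ≡ 2 ℕ.* n ℕ.+ 2 → β v ℤ.≤ β (c ∷ dPow n ++ c ∷ [])) ×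
    ((v : List CD) → deg v ≡ 2 ℕ.* n ℕ.+ 5 →
    (β v ℤ.≤ β (c ∷ d ∷ c ∷ dPow n ++ c ∷ [])) × (β v ℤ.≤ β (c ∷ dPow n ++ c ∷ d ∷ c ∷ [])))
theorem6p1 β cdIndex n 1≤n =
  (λ v |v| → compare v |v| (deg-cdⁿc n) (e-≤-evenMax n 1≤n v |v|) (e-cdⁿc n 1≤n)) ,
  (λ v |v| → compare v |v| (deg-cdcdⁿc n) (e-≤-oddMax n v |v|) (e-cdcdⁿc n 1≤n) ,
             compare v |v| (deg-cdⁿcdc n) (e-≤-oddMax n v |v|) (e-cdⁿcdc n 1≤n))
  where
  open Maximum (normalise β) (normalise-riccati β cdIndex)
  compare : ∀ v {w D M} → deg v ≡ D → deg w ≡ D → normalise β v ≤ M → normalise β w ≡ M → β v ℤ.≤ β w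
  compare v {w} |v| |w| v≤M w≡M = normalise-cancel-≤ β v w (trans |v| (sym |w|)) (ℚ.≤-trans v≤M (ℚ.≤-reflexive (sym w≡M)))
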